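{- Let $A$ be a finite alphabet, let $x$ be an infinite non-ultimately periodic word over $A$, let $u\in\mathrm{Fac}(x)$ with $|u|\geq 1$ be primitive and such that $u^5$ is recurrent in $x$, and let $k\geq 1$ be an integer such that $\mathrm{maxPL}(x)\leq k$. Then there is an infinite non-ultimately periodic word $\overline x$ over $A$ such that $u^5\notin\mathrm{Fac}(\overline x)$, $(u^R)^5\notin\mathrm{Fac}(\overline x)$, $\Psi(x,u)\subseteq\mathrm{Fac}(\overline x)$, and $\mathrm{maxPL}(\overline x)\leq 3k^3$.
   Context: $A$ is a finite alphabet, $A^+$ is the set of nonempty finite words over $A$. For a finite word $v=a_1a_2\cdots a_n$ (letters $a_i$), $v^R=a_n\cdots a_2a_1$ is its reversal; $v$ is a palindrome if it is nonempty and $v=v^R$. The palindromic length $\mathrm{PL}(v)$ of a nonempty finite word $v$ is the minimal number $m$ such that $v=v_1v_2\cdots v_m$ with all $v_i$ nonempty palindromes. For a finite or infinite word $y$, $\mathrm{Fac}(y)$ is the set of all finite factors (contiguous subwords) of $y$, including the empty word, and $\mathrm{maxPL}(y)=\max\{\mathrm{PL}(t)\mid t\in\mathrm{Fac}(y)\}$ ($t$ nonempty); $\mathrm{maxPL}(y)\le k$ means that every nonempty finite factor of $y$ has palindromic length at most $k$. An infinite word $x$ is ultimately periodic if $x=x_1x_2^\infty$ for some $x_1,x_2\in A^+$, and non-ultimately periodic otherwise. For a rational $q\ge 1$, a word $v$ is the $q$-power $u^q$ of $u\in A^+$ if $v=u^{\lfloor q\rfloor}\overline u$ with $\overline u$ a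 proper (possibly empty) prefix of $u$ and $|v|=q|u|$. A word $v\in A^+$ is primitive if there are no $t\in A^+$ and rational number $q\geq 2$ such that $v=t^q$, i.e. such that $v=t^{\lfloor q\rfloor}\overline t$ with $\overline t$ a proper (possibly empty) prefix of $t$ and $|v|=q|t|$. A nonempty factor is recurrent in $x$ if it has infinitely many occurrences in $x$. For an infinite word $x$ and a nonempty finite word $u$, $\Psi(x,u)=\{t\in\mathrm{Fac}(x)\mid u\notin\mathrm{Fac}(t)\text{ and }u^R\notin\mathrm{Fac}(t)\}$. -}

module Defs where

open import Level using (0ℓ)
open import Data.Nat using (ℕ; zero; suc; _+_; _≤_)
open import Data.Nat.DivMod using (_mod_)
open import Data.Integer using (+_; ∣_∣)
open import Data.Rational as ℚ using (ℚ; _/_; floor)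
open import Data.List using (List; []; _∷_; _++_; length; reverse; concat; replicate; applyUpTo; lookup)
open import Data.List.NonEmpty using (List⁺; toList)
open import Data.List.Relation.Unary.All using (All)
open import Data.List.Relation.Binary.Infix.Heterogeneous using (Infix)
open import Data.List.Relation.Binary.Prefix.Heterogeneous using (Prefix)
open import Data.Product using (∃; ∃₂; _×_)
open import Relation.Nullary using (¬_)
open import Relation.Unary using (Pred; _∈_; _∉_)
open import Relation.Binary.PropositionalEquality using (_≡_; _≢_; _≗_)

infixr 5 _⧺_
infixr 8 _^ʷ_
infix  9 _^∞

InfiniteWord : Set → Set
InfiniteWord A = ℕ → A

_⧺_ : {A : Set} → List A → InfiniteWord A → InfiniteWord A
([]      ⧺ y) i       = y i
((a ∷ v) ⧺ y) zero    = a
((a ∷ v) ⧺ y) (suc i) = (v ⧺ y) i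

_^∞ : {A : Set} → List⁺ A → InfiniteWord A
(v ^∞) i = lookup (toList v) (i mod length (toList v))

UltimatelyPeriodic : {A : Set} → InfiniteWord A → Set
UltimatelyPeriodic {A} x = ∃₂ λ (x₁ x₂ : List⁺ A) → x ≗ toList x₁ ⧺ x₂ ^∞

_^ʷ_ : {A : Set} → List A → ℕ → List A
u ^ʷ m = concat (replicate m u)

ProperPrefix : {A : Set} → List A → List A → Set
ProperPrefix s t = Prefix _≡_ s t × s ≢ t

-- v = t^q.  Only used for q ≥ 1, where ∣ floor q ∣ is ⌊q⌋ as a natural number.
IsPower : {A : Set} → List A → List A → ℚ → Set
IsPower v t q = ∃ λ s →
  ProperPrefix s t ×
  v ≡ t ^ʷ ∣ floor q ∣ ++ s ×
  + length v / 1 ≡ q ℚ.* (+ length t / 1)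

Primitive : {A : Set} → List A → Set
Primitive {A} v =
  v ≢ [] × ¬ (∃₂ λ (t : List A) (q : ℚ) → t ≢ [] × + 2 / 1 ℚ.≤ q × IsPower v t q)

Palindrome : {A : Set} → List A → Set
Palindrome v = v ≢ [] × v ≡ reverse v

PalFactorization : {A : Set} → List A → List (List A) → Set
PalFactorization v ps = All Palindrome ps × v ≡ concat ps

-- The graph of PL: m is the least number of palindromes in a factorization of v.
PL : {A : Set} → List A → ℕ → Set
PL v m =
  (∃ λ ps → PalFactorization v ps × length ps ≡ m) ×
  (∀ ps → PalFactorization v ps → m ≤ length ps)

Fac : {A : Set} → List A → Pred (List A) 0ℓ
Fac t v = Infix _≡_ v t

OccursAt : {A : Set} → InfiniteWord A → List A → ℕ → Set
OccursAt x v i = applyUpTo (λ j → x (i + j)) (length v) ≡ v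

Fac∞ : {A : Set} → InfiniteWord A → Pred (List A) 0ℓ
Fac∞ x v = ∃ λ i → OccursAt x v i

Recurrent : {A : Set} → InfiniteWord A → List A → Set
Recurrent x v = v ≢ [] × (∀ N → ∃ λ i → N ≤ i × OccursAt x v i)

MaxPL≤ : {A : Set} → InfiniteWord A → ℕ → Set
MaxPL≤ x k = ∀ t → t ≢ [] → t ∈ Fac∞ x → ∃ λ m → PL t m × m ≤ k

Ψ : {A : Set} → InfiniteWord A → List A → Pred (List A) 0ℓ
Ψ x u t = t ∈ Fac∞ x × u ∉ Fac t × reverse u ∉ Fac t

module Submission where

-- Write n = |u|.  A position i is marked when the window x[i, i + n] has period n and its prefix of
-- length n is conjugate to u or to its reversal; every maximal run with such a root is a maximal block
-- of marked positions.  The word x̄ is obtained by deleting a multiple of n positions at the end of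
-- each block of length ≥ 3n, so that between 2n and 4n marked positions remain.  Windows of length
-- n + 1 survive, hence x̄ has no fifth power of u or of its reversal, while a factor without u and its
-- reversal can be moved inside its block away from the deleted positions.  The marking is invariant
-- under reversal, so a palindrome of x loses its symmetry only in the runs at its two ends, and these
-- contribute boundedly many further factors of x.
-- Each block keeps either two or three periods (plus the remainder), according to a colouring f of the
-- block lengths.  If x̄ were ultimately periodic for every f, then so would be the sequence of block
-- lengths of x, by a diagonal argument when they are unbounded, and then x itself.

open import Defs
open import Level using (0ℓ)
open import Axiom.ExcludedMiddle using (ExcludedMiddle)
open import Data.Bool using (Bool; true; false; not; if_then_else_; _∧_; T)
open import Data.Bool.Properties using (not-¬; ¬-not)
open import Data.Nat
open import Data.Nat.DivMod
open import Data.Nat.Divisibility using (_∣_; m∣n⇒n≡quotient*m; quotient; m≤n⇒m!∣n!; ∣-trans; m∣m*n)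
open import Data.Nat.Induction using (<-rec)
open import Data.Nat.Properties
open import Data.Nat.Tactic.RingSolver using (solve-∀)
open import Data.Fin as Fin using (Fin; toℕ)
open import Data.Fin.Properties using (toℕ-fromℕ<; toℕ-injective)
open import Data.List using (List; []; _∷_; _∷ʳ_; [_]; _++_; length; reverse; concat; applyUpTo; lookup)
open import Data.List.NonEmpty using (List⁺; _∷_; toList)
open import Data.List.Properties
  using (length-++; length-reverse; ++-assoc; ++-identityʳ; concat-++; unfold-reverse; reverse-++;
         reverse-involutive; ∷-injective; ∷-injectiveˡ; ∷-injectiveʳ; ∷ʳ-injective)
open import Data.List.Relation.Binary.Infix.Heterogeneous using (MkView; fromView)
open import Data.List.Relation.Binary.Pointwise using (≡⇒Pointwise-≡)
open import Data.List.Relation.Unary.All using ([]; _∷_)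
open import Data.List.Relation.Unary.All.Properties using (++⁺)
open import Data.Product using (∃; ∃₂; _×_; _,_; proj₁; proj₂)
open import Data.Sum using (_⊎_; inj₁; inj₂)
open import Function using (_∘_; case_of_)
open import Function.Bundles using (_↔_)
open import Relation.Binary.Definitions using (tri<; tri≈; tri>)
open import Relation.Binary.PropositionalEquality hiding ([_])
open import Relation.Nullary using (¬_; Dec; yes; no; does; contradiction)
open import Relation.Nullary.Decidable using (dec-true; dec-false; decidable-stable)
open import Relation.Unary using (_∈_; _∉_; _⊆_)

-- Marks depend only on windows of n + 1 letters, and by `window` the windows of x̄ are those of x
-- at the kept positions. Hence x̄ carries the marking of x restricted to these positions, and
-- questions about powers and periods of x̄ become questions about blocks. The constants follow. A
-- fifth power of a conjugate of u marks 4n consecutive positions, so fewer than 4n may stay in a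
-- block. A factor without u and its reversal meets a run in fewer than 2n letters, so 2n positions
-- in front of each cut leave it room. The possible new lengths 2n + r and 3n + r with r < n lie on
-- different sides of 3n, so x̄ reveals the colour of every long block. The freedom of f answers an
-- obstacle: x may owe its aperiodicity to the block lengths alone, and a fixed rule of shortening
-- could erase it. A palindrome of x costs at most k pieces for its initial run, 1 for its symmetric
-- middle and 2k for its end. A factor has at most k palindromes, giving k(3k + 1), which is at most
-- 3k^3 once k is at least 2; for k = 1 the word x would be constant.

private variable
  A B : Set

-- Factors of infinite words as lists

seg : (ℕ → A) → ℕ → ℕ → List A
seg x s zero    = []
seg x s (suc m) = x s ∷ seg x (suc s) m

seg-length : ∀ (x : ℕ → A) s m → length (seg x s m) ≡ m
seg-length x s zero    = refl
seg-length x s (suc m) = cong suc (seg-length x (suc s) m)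

seg-cong : ∀ (x y : ℕ → A) s t m → (∀ h → h < m → x (s + h) ≡ y (t + h)) → seg x s m ≡ seg y t m
seg-cong x y s t zero    eq = refl
seg-cong x y s t (suc m) eq = cong₂ _∷_
  (subst₂ (λ i j → x i ≡ y j) (+-identityʳ s) (+-identityʳ t) (eq 0 z<s))
  (seg-cong x y (suc s) (suc t) m λ h h<m →
    subst₂ (λ i j → x i ≡ y j) (+-suc s h) (+-suc t h) (eq (suc h) (s<s h<m)))

seg-split : ∀ (x : ℕ → A) s m m′ → seg x s (m + m′) ≡ seg x s m ++ seg x (s + m) m′
seg-split x s zero    m′ = cong (λ i → seg x i m′) (sym (+-identityʳ s))
seg-split x s (suc m) m′ = cong (x s ∷_) (trans (seg-split x (suc s) m m′)
  (cong (λ i → seg x (suc s) m ++ seg x i m′) (sym (+-suc s m))))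

seg-snoc : ∀ (x : ℕ → A) s m → seg x s (suc m) ≡ seg x s m ∷ʳ x (s + m)
seg-snoc x s m = trans (cong (seg x s) (+-comm 1 m)) (seg-split x s m 1)

seg-at : ∀ (x y : ℕ → A) s t m → seg x s m ≡ seg y t m → ∀ h → h < m → x (s + h) ≡ y (t + h)
seg-at x y s t (suc m) eq zero    _ =
  subst₂ (λ i j → x i ≡ y j) (sym (+-identityʳ s)) (sym (+-identityʳ t)) (∷-injectiveˡ eq)
seg-at x y s t (suc m) eq (suc h) (s≤s h<m) =
  subst₂ (λ i j → x i ≡ y j) (sym (+-suc s h)) (sym (+-suc t h))
    (seg-at x y (suc s) (suc t) m (∷-injectiveʳ eq) h h<m)

-- Mirror positions are encoded throughout as pairs with `suc (i + j) ≡ m`, which avoids truncated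
-- subtraction.
seg-reverse : ∀ (x y : ℕ → A) s t m →
  (∀ i j → suc (i + j) ≡ m → y (t + i) ≡ x (s + j)) → seg y t m ≡ reverse (seg x s m)
seg-reverse x y s t zero    eq = refl
seg-reverse x y s t (suc m) eq = begin
  y t ∷ seg y (suc t) m              ≡⟨ cong₂ _∷_ (subst (λ i → y i ≡ x (s + m)) (+-identityʳ t) (eq 0 m refl))
                                         (seg-reverse x y s (suc t) m λ i j e →
                                           subst (λ k → y k ≡ x (s + j)) (+-suc t i) (eq (suc i) j (cong suc e))) ⟩
  x (s + m) ∷ reverse (seg x s m)    ≡⟨ sym (reverse-++ (seg x s m) [ x (s + m) ]) ⟩
  reverse (seg x s m ∷ʳ x (s + m))   ≡⟨ cong reverse (sym (seg-snoc x s m)) ⟩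
  reverse (seg x s (suc m))          ∎
  where open ≡-Reasoning

++-split : ∀ (v v′ : List A) {w w′} → length v ≡ length v′ → v ++ w ≡ v′ ++ w′ → v ≡ v′ × w ≡ w′
++-split []      []        _ eq = refl , eq
++-split (a ∷ v) (b ∷ v′) le eq with ∷-injective eq
... | refl , eq′ with ++-split v v′ (suc-injective le) eq′
... | refl , eq″ = refl , eq″

seg-++ : ∀ (x : ℕ → A) s m {v w} → seg x s m ≡ v ++ w →
  seg x s (length v) ≡ v × seg x (s + length v) (length w) ≡ w
seg-++ x s m {v} {w} eq = ++-split _ v (seg-length x s _) (begin
  seg x s (length v) ++ seg x (s + length v) (length w) ≡⟨ sym (seg-split x s (length v) (length w)) ⟩
  seg x s (length v + length w)  ≡⟨ cong (seg x s) (sym (length-++ v)) ⟩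
  seg x s (length (v ++ w))      ≡⟨ cong (seg x s ∘ length) (sym eq) ⟩
  seg x s (length (seg x s m))   ≡⟨ cong (seg x s) (seg-length x s m) ⟩
  seg x s m                      ≡⟨ eq ⟩
  v ++ w                         ∎)
  where open ≡-Reasoning

applyUpTo≡seg : ∀ (x : ℕ → A) s m → applyUpTo (λ j → x (s + j)) m ≡ seg x s m
applyUpTo≡seg x s m = go x (λ j → x (s + j)) s m λ j → refl
  where
  go : ∀ (x y : ℕ → A) s m → (∀ j → y j ≡ x (s + j)) → applyUpTo y m ≡ seg x s m
  go x y s zero    eq = refl
  go x y s (suc m) eq = cong₂ _∷_ (trans (eq 0) (cong x (+-identityʳ s)))
    (go x (y ∘ suc) (suc s) m λ j → trans (eq (suc j)) (cong x (+-suc s j)))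

seg⇒OccursAt : ∀ (x : ℕ → A) s m {v} → seg x s m ≡ v → OccursAt x v s
seg⇒OccursAt x s m refl =
  trans (applyUpTo≡seg x s _) (cong (seg x s) (seg-length x s m))

OccursAt⇒seg : ∀ (x : ℕ → A) {v} s → OccursAt x v s → seg x s (length v) ≡ v
OccursAt⇒seg x s eq = trans (sym (applyUpTo≡seg x s _)) eq

-- Eventual periodicity, closed under maps and pairs, and ultimate periodicity

EventuallyPeriodic : (ℕ → A) → Set
EventuallyPeriodic s = ∃₂ λ N p → ∀ i → N ≤ i → s (suc p + i) ≡ s i

EP-map : (f : A → B) {s : ℕ → A} → EventuallyPeriodic s → EventuallyPeriodic (f ∘ s)
EP-map f (N , p , per) = N , p , λ i N≤i → cong f (per i N≤i)

EP-multiple : ∀ {s : ℕ → A} {N P} → (∀ i → N ≤ i → s (P + i) ≡ s i) →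
  ∀ m i → N ≤ i → s (m * P + i) ≡ s i
EP-multiple per zero i N≤i = refl
EP-multiple {s = s} {P = P} per (suc m) i N≤i =
  trans (cong s (+-assoc P (m * P) i))
    (trans (per (m * P + i) (≤-trans N≤i (m≤n+m i (m * P)))) (EP-multiple per m i N≤i))

EP-pair : {s : ℕ → A} {t : ℕ → B} → EventuallyPeriodic s → EventuallyPeriodic t →
  EventuallyPeriodic (λ i → s i , t i)
-- The common period is the product `suc p * suc p′`; its predecessor is `p′ + p * suc p′` by
-- computation.
EP-pair {s = s} {t} (N , p , per) (N′ , p′ , per′) = N ⊔ N′ , p′ + p * suc p′ , λ i N≤i → cong₂ _,_
  (trans (cong (λ k → s (k + i)) (*-comm (suc p) (suc p′)))
    (EP-multiple per (suc p′) i (m⊔n≤o⇒m≤o N N′ N≤i)))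
  (EP-multiple per′ (suc p) i (m⊔n≤o⇒n≤o N N′ N≤i))

⧺-length : ∀ (v : List A) y i → (v ⧺ y) (length v + i) ≡ y i
⧺-length []      y i = refl
⧺-length (a ∷ v) y i = ⧺-length v y i

∞-period : ∀ (w : List⁺ A) i → (w ^∞) (length (toList w) + i) ≡ (w ^∞) i
∞-period w@(_ ∷ as) i = cong (lookup (toList w)) (toℕ-injective (begin
  toℕ ((L + i) mod L)  ≡⟨ toℕ-fromℕ< _ ⟩
  (L + i) % L          ≡⟨ cong (_% L) (+-comm L i) ⟩
  (i + L) % L          ≡⟨ [m+n]%n≡m%n i L ⟩
  i % L                ≡⟨ sym (toℕ-fromℕ< _) ⟩
  toℕ (i mod L)        ∎))
  where
  open ≡-Reasoning
  L = length (toList w)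

UltimatelyPeriodic⇒EP : {x : InfiniteWord A} → UltimatelyPeriodic x → EventuallyPeriodic x
UltimatelyPeriodic⇒EP {x = x} (x₁ , x₂@(_ ∷ as) , eq) = N , length as , λ i N≤i →
  case m≤n⇒∃[o]m+o≡n N≤i of λ where
    (j , refl) → begin
      x (P + (N + j))                       ≡⟨ cong x (swap P N j) ⟩
      x (N + (P + j))                       ≡⟨ eq _ ⟩
      (toList x₁ ⧺ x₂ ^∞) (N + (P + j))     ≡⟨ ⧺-length (toList x₁) _ _ ⟩
      (x₂ ^∞) (P + j)                       ≡⟨ ∞-period x₂ j ⟩
      (x₂ ^∞) j                             ≡⟨ sym (⧺-length (toList x₁) _ _) ⟩
      (toList x₁ ⧺ x₂ ^∞) (N + j)           ≡⟨ sym (eq _) ⟩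
      x (N + j)                             ∎
  where
  open ≡-Reasoning
  N = length (toList x₁)
  P = length (toList x₂)
  swap : ∀ a b c → a + (b + c) ≡ b + (a + c)
  swap = solve-∀

seg-⧺ : ∀ (x y : ℕ → A) s m → (∀ j → y j ≡ x (s + m + j)) → ∀ i → (seg x s m ⧺ y) i ≡ x (s + i)
seg-⧺ x y s zero    eq i = trans (eq i) (cong (λ k → x (k + i)) (+-identityʳ s))
seg-⧺ x y s (suc m) eq zero = cong x (sym (+-identityʳ s))
seg-⧺ x y s (suc m) eq (suc i) =
  trans (seg-⧺ x y (suc s) m (λ j → trans (eq j) (cong (λ k → x (k + j)) (+-suc s m))) i)
    (cong x (sym (+-suc s i)))

lookup-seg : ∀ (x : ℕ → A) s m (i : Fin (length (seg x s m))) → lookup (seg x s m) i ≡ x (s + toℕ i)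
lookup-seg x s (suc m) Fin.zero    = cong x (sym (+-identityʳ s))
lookup-seg x s (suc m) (Fin.suc i) = trans (lookup-seg x (suc s) m i) (cong x (sym (+-suc s (toℕ i))))

EP⇒UltimatelyPeriodic : {x : InfiniteWord A} → EventuallyPeriodic x → UltimatelyPeriodic x
EP⇒UltimatelyPeriodic {x = x} (N , p , per) =
  -- The prefix has `suc N` letters because `x₁` must be nonempty even for N = 0.
  (x 0 ∷ seg x 1 N) , w , λ i → sym (seg-⧺ x (w ^∞) 0 (suc N) tail i)
  where
  open ≡-Reasoning
  w = x (suc N) ∷ seg x (suc (suc N)) p
  shape : ∀ a b c → a + (b + c) ≡ c + (a + b)
  shape = solve-∀
  tail : ∀ j → (w ^∞) j ≡ x (suc N + j)
  tail j = begin
    lookup (seg x (suc N) (suc p)) (j mod L)  ≡⟨ lookup-seg x (suc N) (suc p) (j mod L) ⟩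
    x (suc N + toℕ (j mod L))                 ≡⟨ cong (λ k → x (suc N + k)) (toℕ-fromℕ< _) ⟩
    x (suc N + j % L)                         ≡⟨ cong (λ k → x (suc N + j % suc k)) (seg-length x (suc (suc N)) p) ⟩
    x (suc N + j % suc p)                     ≡⟨ sym (EP-multiple per (j / suc p) _ (≤-trans (n≤1+n N) (m≤m+n (suc N) _))) ⟩
    x (j / suc p * suc p + (suc N + j % suc p)) ≡⟨ cong x (shape (j / suc p * suc p) (suc N) (j % suc p)) ⟩
    x (j % suc p + (j / suc p * suc p + suc N)) ≡⟨ cong x (sym (+-assoc (j % suc p) _ (suc N))) ⟩
    x (j % suc p + j / suc p * suc p + suc N) ≡⟨ cong (λ k → x (k + suc N)) (sym (m≡m%n+[m/n]*n j (suc p))) ⟩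
    x (j + suc N)                             ≡⟨ cong x (+-comm j (suc N)) ⟩
    x (suc N + j)                             ∎
    where L = length (toList w)

EP-cong : {s t : ℕ → A} → (∀ i → s i ≡ t i) → EventuallyPeriodic s → EventuallyPeriodic t
EP-cong eq (N , p , per) = N , p , λ i N≤i → trans (sym (eq _)) (trans (per i N≤i) (eq i))

-- A single j bounds the preperiod and makes `j !` a multiple of the period. Thus one test for each
-- j excludes all eventual periods, which is the enumeration the diagonal argument runs through.
EP-factorial : {s : ℕ → A} → EventuallyPeriodic s → ∃ λ j → ∀ i → j ≤ i → s (j ! + i) ≡ s i
EP-factorial {s = s} (N , p , per) = j , λ i j≤i →
  trans (cong (λ m → s (m + i)) (m∣n⇒n≡quotient*m p∣j!))
    (EP-multiple per (quotient p∣j!) i (≤-trans (m≤m⊔n N (suc p)) j≤i))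
  where
  j = N ⊔ suc p
  p∣j! : suc p ∣ j !
  p∣j! = ∣-trans (m∣m*n (p !)) (m≤n⇒m!∣n! (m≤n⊔m N (suc p)))

-- Colourings that destroy periodicity

prefixMax : (ℕ → ℕ) → ℕ → ℕ
prefixMax s zero    = 0
prefixMax s (suc m) = prefixMax s m ⊔ s m

≤-prefixMax : ∀ s m i → i < m → s i ≤ prefixMax s m
≤-prefixMax s (suc m) i (s≤s i≤m) with m≤n⇒m<n∨m≡n i≤m
... | inj₁ i<m  = ≤-trans (≤-prefixMax s m i i<m) (m≤m⊔n _ _)
... | inj₂ refl = m≤n⊔m (prefixMax s m) (s m)

Bounded : (ℕ → ℕ) → Set
Bounded s = ∃ λ b → ∀ i → s i ≤ b

-- The larger value c is at least b, hence not yet coloured by an earlier stage and free to be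
-- chosen.
LargeMismatch : (ℕ → ℕ) → ℕ → ℕ → ℕ → Set
LargeMismatch s P N b = ∃₂ λ i c → ∃ λ d → N ≤ i × d < c × b ≤ c ×
  (s i ≡ c × s (P + i) ≡ d ⊎ s i ≡ d × s (P + i) ≡ c)

-- If the larger value of every mismatch at distance P beyond N were below b, each step from i′ to P
-- + i′ would stay under the maximum of b and the first P + N values, so s would be bounded.
largeMismatch : ExcludedMiddle 0ℓ → ∀ s → ¬ Bounded s → ∀ P N b → 1 ≤ P → LargeMismatch s P N b
largeMismatch em s unbounded P N b 1≤P with em {LargeMismatch s P N b}
... | yes found = found
... | no none = contradiction (M , bound) unbounded
  where
  M = prefixMax s (P + N) ⊔ b
  bound : ∀ i → s i ≤ M
  bound = <-rec _ step
    where
    step : ∀ i → (∀ {i′} → i′ < i → s i′ ≤ M) → s i ≤ M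
    step i rec with i <? P + N
    ... | yes i<P+N = ≤-trans (≤-prefixMax s _ i i<P+N) (m≤m⊔n _ _)
    ... | no i≮P+N with m≤n⇒∃[o]m+o≡n (≤-trans (m≤m+n P N) (≮⇒≥ i≮P+N))
    ... | i′ , refl = byOrder (<-cmp (s i′) (s (P + i′)))
      where
      N≤i′ : N ≤ i′
      N≤i′ = +-cancelˡ-≤ P N i′ (≮⇒≥ i≮P+N)
      byOrder : _ → s (P + i′) ≤ M
      byOrder (tri< lt _ _) with b ≤? s (P + i′)
      ... | yes b≤ = contradiction (i′ , _ , _ , N≤i′ , lt , b≤ , inj₂ (refl , refl)) none
      ... | no b≰  = ≤-trans (<⇒≤ (≰⇒> b≰)) (m≤n⊔m _ b)
      byOrder (tri≈ _ eq _) = ≤-trans (≤-reflexive (sym eq)) (rec (m<n+m i′ {P} 1≤P))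
      byOrder (tri> _ _ gt) with b ≤? s i′
      ... | yes b≤ = contradiction (i′ , _ , _ , N≤i′ , gt , b≤ , inj₁ (refl , refl)) none
      ... | no b≰  = ≤-trans (<⇒≤ (<-trans gt (≰⇒> b≰))) (m≤n⊔m _ b)

-- Greedy diagonalisation: at stage j, the colour of a value c above all values treated before is
-- chosen so that the coloured sequence does not have period j ! from j on.
module Diagonal (s : ℕ → ℕ) (b₀ : ℕ) (mismatch : ∀ P N b → 1 ≤ P → LargeMismatch s P N b) where

  pick : ∀ j b → LargeMismatch s (j !) j b
  pick j b = mismatch (j !) j b (1≤n! j)

  value lower : ℕ → ℕ → ℕ
  value j b = proj₁ (proj₂ (pick j b))
  lower j b = proj₁ (proj₂ (proj₂ (pick j b)))

  bound : ℕ → ℕ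
  bound zero    = b₀
  bound (suc j) = suc (value j (bound j))

  stage : ℕ → ℕ → Bool
  stage zero    m = false
  stage (suc j) m =
    if does (m ≟ value j (bound j)) then not (stage j (lower j (bound j))) else stage j m

  bound≤value : ∀ j → bound j ≤ value j (bound j)
  bound≤value j = let (_ , _ , _ , _ , _ , b≤ , _) = pick j (bound j) in b≤

  lower<value : ∀ j → lower j (bound j) < value j (bound j)
  lower<value j = let (_ , _ , _ , _ , lt , _ , _) = pick j (bound j) in lt

  j≤bound : ∀ j → j ≤ bound j
  j≤bound zero    = z≤n
  j≤bound (suc j) = s≤s (≤-trans (j≤bound j) (bound≤value j))

  bound-mono : ∀ d j → bound j ≤ bound (d + j)
  bound-mono zero    j = ≤-refl
  bound-mono (suc d) j = ≤-trans (bound-mono d j) (≤-trans (bound≤value (d + j)) (n≤1+n _))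

  stage-≢ : ∀ j m → m ≢ value j (bound j) → stage (suc j) m ≡ stage j m
  stage-≢ j m m≢ rewrite dec-false (m ≟ value j (bound j)) m≢ = refl

  stage-≡ : ∀ j → stage (suc j) (value j (bound j)) ≡ not (stage j (lower j (bound j)))
  stage-≡ j rewrite dec-true (value j (bound j) ≟ value j (bound j)) refl = refl

  stable : ∀ d j m → m < bound j → stage (d + j) m ≡ stage j m
  stable zero    j m m< = refl
  stable (suc d) j m m< = trans
    (stage-≢ (d + j) m (<⇒≢ (<-≤-trans m< (≤-trans (bound-mono d j) (bound≤value (d + j))))))
    (stable d j m m<)

  -- Since m lies below `bound (suc m)`, its colour no longer changes after stage `suc m`, and the
  -- limit of the stages can be read there.
  colour : ℕ → Bool
  colour m = stage (suc m) m

  colour-stage : ∀ j m → m < bound j → colour m ≡ stage j m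
  colour-stage j m m< with ≤-total (suc m) j
  ... | inj₁ le with m≤n⇒∃[o]m+o≡n le
  ...   | d , refl = trans (sym (stable d (suc m) m (j≤bound (suc m))))
                       (cong (λ k → stage k m) (+-comm d (suc m)))
  colour-stage j m m< | inj₂ le with m≤n⇒∃[o]m+o≡n le
  ...   | d , eq = trans (cong (λ k → stage k m) (trans (sym eq) (+-comm j d))) (stable d j m m<)

  colour-low : ∀ m → m < b₀ → colour m ≡ false
  colour-low m m<b₀ = colour-stage 0 m m<b₀

  colour-opposite : ∀ j → colour (value j (bound j)) ≡ not (colour (lower j (bound j)))
  colour-opposite j = begin
    colour c                ≡⟨ colour-stage (suc j) c ≤-refl ⟩
    stage (suc j) c         ≡⟨ stage-≡ j ⟩
    not (stage j d)         ≡⟨ cong not (sym (stage-≢ j d (<⇒≢ (lower<value j)))) ⟩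
    not (stage (suc j) d)   ≡⟨ cong not (sym (colour-stage (suc j) d (m≤n⇒m≤1+n (lower<value j)))) ⟩
    not (colour d)          ∎
    where
    open ≡-Reasoning
    c = value j (bound j)
    d = lower j (bound j)

  colour-aperiodic : ¬ EventuallyPeriodic (colour ∘ s)
  colour-aperiodic ep with EP-factorial ep
  ... | j , per with pick j (bound j) | colour-opposite j
  ...   | i , c , d , j≤i , _ , _ , inj₁ (refl , refl) | opp = not-¬ (sym (per i j≤i)) opp
  ...   | i , c , d , j≤i , _ , _ , inj₂ (refl , refl) | opp = not-¬ (per i j≤i) opp

-- For unbounded s, `Diagonal` refutes the hypothesis. For bounded s, each threshold colouring
-- raises the truncation of s by one, and finitely many of them recover s. Colours below b₀ are
-- fixed because a block that is too short to be cut cannot display one.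
EP-colourings : ExcludedMiddle 0ℓ → ∀ (s : ℕ → ℕ) b₀ →
  (∀ (f : ℕ → Bool) → (∀ m → m < b₀ → f m ≡ false) → EventuallyPeriodic (f ∘ s)) →
  EventuallyPeriodic (λ i → s i ⊓ b₀) → EventuallyPeriodic s
EP-colourings em s b₀ coloured base with em {Bounded s}
... | no unbounded = contradiction (coloured colour colour-low) colour-aperiodic
  where open Diagonal s b₀ (largeMismatch em s unbounded)
... | yes (b , s≤b) = EP-cong (λ i → m≤n⇒m⊓n≡m (≤-trans (s≤b i) (m≤m+n b b₀))) (truncated b)
  where
  above : ℕ → ℕ → Bool
  above c m = does (c <? m)
  increment : ∀ c m → m ⊓ c + (if above c m then 1 else 0) ≡ m ⊓ suc c
  increment c m with c <? m
  ... | yes c<m rewrite dec-true (c <? m) c<m | m≥n⇒m⊓n≡n (<⇒≤ c<m) | m≥n⇒m⊓n≡n c<m = +-comm c 1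
  ... | no c≮m rewrite dec-false (c <? m) c≮m | m≤n⇒m⊓n≡m (≮⇒≥ c≮m)
                     | m≤n⇒m⊓n≡m (≤-trans (≮⇒≥ c≮m) (n≤1+n c)) = +-identityʳ m
  truncated : ∀ d → EventuallyPeriodic (λ i → s i ⊓ (d + b₀))
  truncated zero    = base
  truncated (suc d) = EP-cong (λ i → increment (d + b₀) (s i))
    (EP-map (λ (m , t) → m + (if t then 1 else 0))
      (EP-pair (truncated d) (coloured (above (d + b₀))
        λ m m<b₀ → dec-false (d + b₀ <? m) (≤⇒≯ (≤-trans (<⇒≤ m<b₀) (m≤n+m b₀ d))))))

-- Upper bounds for palindromic length, stable under concatenation

PalLength≤ : List A → ℕ → Set
PalLength≤ w m = ∃ λ ps → PalFactorization w ps × length ps ≤ m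

PalLength≤-[] : ∀ {m} → PalLength≤ {A} [] m
PalLength≤-[] = [] , ([] , refl) , z≤n

PalLength≤-pal : ∀ {w : List A} → w ≡ reverse w → PalLength≤ w 1
PalLength≤-pal {w = []}    _   = PalLength≤-[]
PalLength≤-pal {w = a ∷ w} pal = [ a ∷ w ] , (((λ ()) , pal) ∷ [] , sym (++-identityʳ (a ∷ w))) , s≤s z≤n

PalLength≤-++ : ∀ {v w : List A} {m m′} → PalLength≤ v m → PalLength≤ w m′ → PalLength≤ (v ++ w) (m + m′)
PalLength≤-++ (ps , (pal , refl) , le) (qs , (pal′ , refl) , le′) =
  ps ++ qs , (++⁺ pal pal′ , concat-++ ps qs) ,
  subst (_≤ _) (sym (length-++ ps)) (+-mono-≤ le le′)

PalLength≤-mono : ∀ {w : List A} {m m′} → m ≤ m′ → PalLength≤ w m → PalLength≤ w m′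
PalLength≤-mono m≤ (ps , pal , le) = ps , pal , ≤-trans le m≤

-- Descent on m: excluded middle decides whether one palindrome fewer suffices.
PalLength≤⇒PL : ExcludedMiddle 0ℓ → ∀ {w : List A} m → PalLength≤ w m → ∃ λ l → PL w l × l ≤ m
PalLength≤⇒PL em zero    (ps , pal , le) = 0 , ((ps , pal , n≤0⇒n≡0 le) , λ _ _ → z≤n) , z≤n
PalLength≤⇒PL em {w} (suc m) (ps , pal , le) with em {PalLength≤ w m}
... | yes shorter = let (l , pl , l≤m) = PalLength≤⇒PL em m shorter in l , pl , m≤n⇒m≤1+n l≤m
... | no minimal = suc m , ((ps , pal , ≤-antisym le (long ps pal)) , long) , ≤-refl
  where
  long : ∀ qs → PalFactorization w qs → suc m ≤ length qs
  long qs pal′ = ≰⇒> λ le′ → minimal (qs , pal′ , le′)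

-- Reading a word along its undeleted positions

gather : (ℕ → Bool) → (ℕ → A) → ℕ → ℕ → List A
gather d f s zero    = []
gather d f s (suc m) = if d s then gather d f (suc s) m else f s ∷ gather d f (suc s) m

gather-skip : ∀ d (f : ℕ → A) s m → d s ≡ true → gather d f s (suc m) ≡ gather d f (suc s) m
gather-skip d f s m ds rewrite ds = refl

gather-keep : ∀ d (f : ℕ → A) s m → d s ≡ false → gather d f s (suc m) ≡ f s ∷ gather d f (suc s) m
gather-keep d f s m ds rewrite ds = refl

gather-split : ∀ d (f : ℕ → A) s m m′ → gather d f s (m + m′) ≡ gather d f s m ++ gather d f (s + m) m′
gather-split d f s zero    m′ = cong (λ i → gather d f i m′) (sym (+-identityʳ s))
gather-split d f s (suc m) m′ rewrite +-suc s m with d s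
... | true  = gather-split d f (suc s) m m′
... | false = cong (f s ∷_) (gather-split d f (suc s) m m′)

gather-none : ∀ d (f : ℕ → A) s m → (∀ h → h < m → d (s + h) ≡ false) → gather d f s m ≡ seg f s m
gather-none d f s zero    kept = refl
gather-none d f s (suc m) kept = trans
  (gather-keep d f s m (trans (cong d (sym (+-identityʳ s))) (kept 0 z<s)))
  (cong (f s ∷_) (gather-none d f (suc s) m λ h h<m → trans (cong d (sym (+-suc s h))) (kept (suc h) (s<s h<m))))

gather-all : ∀ d (f : ℕ → A) s m → (∀ h → h < m → d (s + h) ≡ true) → gather d f s m ≡ []
gather-all d f s zero    gone = refl
gather-all d f s (suc m) gone = trans
  (gather-skip d f s m (trans (cong d (sym (+-identityʳ s))) (gone 0 z<s)))
  (gather-all d f (suc s) m λ h h<m → trans (cong d (sym (+-suc s h))) (gone (suc h) (s<s h<m)))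

gather-snoc-skip : ∀ d (f : ℕ → A) s m → d (s + m) ≡ true → gather d f s (suc m) ≡ gather d f s m
gather-snoc-skip d f s m ds = begin
  gather d f s (suc m)                     ≡⟨ cong (gather d f s) (+-comm 1 m) ⟩
  gather d f s (m + 1)                     ≡⟨ gather-split d f s m 1 ⟩
  gather d f s m ++ gather d f (s + m) 1   ≡⟨ cong (gather d f s m ++_) (gather-skip d f (s + m) 0 ds) ⟩
  gather d f s m ++ []                     ≡⟨ ++-identityʳ _ ⟩
  gather d f s m                           ∎
  where open ≡-Reasoning

gather-snoc-keep : ∀ d (f : ℕ → A) s m → d (s + m) ≡ false → gather d f s (suc m) ≡ gather d f s m ∷ʳ f (s + m)
gather-snoc-keep d f s m ds = begin
  gather d f s (suc m)                     ≡⟨ cong (gather d f s) (+-comm 1 m) ⟩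
  gather d f s (m + 1)                     ≡⟨ gather-split d f s m 1 ⟩
  gather d f s m ++ gather d f (s + m) 1   ≡⟨ cong (gather d f s m ++_) (gather-keep d f (s + m) 0 ds) ⟩
  gather d f s m ∷ʳ f (s + m)              ∎
  where open ≡-Reasoning

-- Deletion and letters have separate mirror hypotheses: in the application the letters on one side
-- are read n places beyond the positions.
gather-reverse : ∀ d d′ (f f′ : ℕ → A) s t m →
  (∀ i j → suc (i + j) ≡ m → d′ (t + i) ≡ d (s + j)) →
  (∀ i j → suc (i + j) ≡ m → f′ (t + i) ≡ f (s + j)) →
  gather d′ f′ t m ≡ reverse (gather d f s m)
gather-reverse d d′ f f′ s t zero    eq eq′ = refl
gather-reverse d d′ f f′ s t (suc m) eq eq′ = byCase (d (s + m)) refl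
  where
  open ≡-Reasoning
  d′t : d′ t ≡ d (s + m)
  d′t = trans (cong d′ (sym (+-identityʳ t))) (eq 0 m refl)
  f′t : f′ t ≡ f (s + m)
  f′t = trans (cong f′ (sym (+-identityʳ t))) (eq′ 0 m refl)
  rest : gather d′ f′ (suc t) m ≡ reverse (gather d f s m)
  rest = gather-reverse d d′ f f′ s (suc t) m
    (λ i j e → trans (cong d′ (sym (+-suc t i))) (eq (suc i) j (cong suc e)))
    (λ i j e → trans (cong f′ (sym (+-suc t i))) (eq′ (suc i) j (cong suc e)))
  byCase : ∀ b → d (s + m) ≡ b → gather d′ f′ t (suc m) ≡ reverse (gather d f s (suc m))
  byCase true ds = begin
    gather d′ f′ t (suc m)           ≡⟨ gather-skip d′ f′ t m (trans d′t ds) ⟩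
    gather d′ f′ (suc t) m           ≡⟨ rest ⟩
    reverse (gather d f s m)         ≡⟨ cong reverse (sym (gather-snoc-skip d f s m ds)) ⟩
    reverse (gather d f s (suc m))   ∎
  byCase false ds = begin
    gather d′ f′ t (suc m)                     ≡⟨ gather-keep d′ f′ t m (trans d′t ds) ⟩
    f′ t ∷ gather d′ f′ (suc t) m              ≡⟨ cong₂ _∷_ f′t rest ⟩
    f (s + m) ∷ reverse (gather d f s m)       ≡⟨ sym (reverse-++ (gather d f s m) [ f (s + m) ]) ⟩
    reverse (gather d f s m ∷ʳ f (s + m))      ≡⟨ cong reverse (sym (gather-snoc-keep d f s m ds)) ⟩
    reverse (gather d f s (suc m))             ∎

-- Blocks of marked positions and the deletion of their ends

module Blocks
  (e : ℕ → Bool) (right : ℕ → ℕ)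
  (right-true : ∀ i h → h < right i → e (i + h) ≡ true)
  (right-false : ∀ i → e (i + right i) ≡ false)
  where

  -- Counts the marked positions immediately before i, with i excluded, whereas `right i` includes
  -- i. Their sum is the length of the block, the same from its first position to the unmarked
  -- position that closes it.
  left : ℕ → ℕ
  left zero    = zero
  left (suc i) = if e i then suc (left i) else zero

  left-true : ∀ i → e i ≡ true → left (suc i) ≡ suc (left i)
  left-true i ei rewrite ei = refl

  left-false : ∀ i → e i ≡ false → left (suc i) ≡ 0
  left-false i ei rewrite ei = refl

  left-suc-≤ : ∀ i → left (suc i) ≤ suc (left i)
  left-suc-≤ i with e i
  ... | true  = ≤-refl
  ... | false = z≤n

  right-unique : ∀ i r → (∀ h → h < r → e (i + h) ≡ true) → e (i + r) ≡ false → right i ≡ r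
  right-unique i r tr fl with <-cmp (right i) r
  ... | tri< lt _ _ = contradiction (trans (sym (tr _ lt)) (right-false i)) λ ()
  ... | tri≈ _ eq _ = eq
  ... | tri> _ _ gt = contradiction (trans (sym (right-true i r gt)) fl) λ ()

  right-≤ : ∀ i r → e (i + r) ≡ false → right i ≤ r
  right-≤ i r fl = ≮⇒≥ λ r< → contradiction (trans (sym (right-true i r r<)) fl) λ ()

  right-zero : ∀ i → e i ≡ false → right i ≡ 0
  right-zero i ei = n≤0⇒n≡0 (right-≤ i 0 (trans (cong e (+-identityʳ i)) ei))

  right-suc : ∀ i → e i ≡ true → right i ≡ suc (right (suc i))
  right-suc i ei = right-unique i _
    (λ { zero _ → trans (cong e (+-identityʳ i)) ei
       ; (suc h) (s≤s h<) → trans (cong e (+-suc i h)) (right-true (suc i) h h<) })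
    (trans (cong e (+-suc i _)) (right-false (suc i)))

  right-pos : ∀ i → e i ≡ true → 0 < right i
  right-pos i ei rewrite right-suc i ei = z<s

  pos-right : ∀ i → 0 < right i → e i ≡ true
  pos-right i 0< = trans (cong e (sym (+-identityʳ i))) (right-true i 0 0<)

  right-+ : ∀ h i → h ≤ right i → h + right (i + h) ≡ right i
  right-+ zero    i h≤ = cong right (+-identityʳ i)
  right-+ (suc h) i h≤ = begin
    suc (h + right (i + suc h))   ≡⟨ cong (λ k → suc (h + right k)) (+-suc i h) ⟩
    suc (h + right (suc i + h))   ≡⟨ cong suc (right-+ h (suc i) (s≤s⁻¹ (subst (suc h ≤_) r-suc h≤))) ⟩
    suc (right (suc i))           ≡⟨ sym r-suc ⟩
    right i                       ∎
    where
    open ≡-Reasoning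
    r-suc : right i ≡ suc (right (suc i))
    r-suc = right-suc i (pos-right i (≤-trans z<s h≤))

  left-+ : ∀ h a → left a ≡ 0 → h ≤ right a → left (a + h) ≡ h
  left-+ zero    a la h≤ = trans (cong left (+-identityʳ a)) la
  left-+ (suc h) a la h≤ = begin
    left (a + suc h)    ≡⟨ cong left (+-suc a h) ⟩
    left (suc (a + h))  ≡⟨ left-true (a + h) (right-true a h h≤) ⟩
    suc (left (a + h))  ≡⟨ cong suc (left-+ h a la (<⇒≤ h≤)) ⟩
    suc h               ∎
    where open ≡-Reasoning

  left-after-false : ∀ z h → e z ≡ false → left (suc z + h) ≤ h
  left-after-false z zero    ez = ≤-reflexive (trans (cong left (+-identityʳ (suc z))) (left-false z ez))
  left-after-false z (suc h) ez = subst (λ i → left i ≤ suc h) (sym (+-suc (suc z) h))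
    (≤-trans (left-suc-≤ (suc z + h)) (s≤s (left-after-false z h ez)))

  -- An unmarked s is counted as the closing position of the block before it, hence `≤` and not `<`
  -- in the last component.
  blockStart : ∀ s → ∃ λ a → a + left s ≡ s × left a ≡ 0 × left s ≤ right a
  blockStart zero    = 0 , refl , refl , z≤n
  blockStart (suc s) = byCase (e s) refl
    where
    byCase : ∀ b → e s ≡ b → ∃ λ a → a + left (suc s) ≡ suc s × left a ≡ 0 × left (suc s) ≤ right a
    byCase false es = suc s , trans (cong (suc s +_) (left-false s es)) (+-identityʳ (suc s)) , left-false s es ,
      subst (_≤ right (suc s)) (sym (left-false s es)) z≤n
    byCase true es with blockStart s
    ... | a , a+ , la , l≤ = a , trans (cong (a +_) (left-true s es)) (trans (+-suc a _) (cong suc a+)) , la ,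
      subst (_≤ right a) (sym (left-true s es))
        (≤∧≢⇒< l≤ λ eq → contradiction (trans (sym es) (trans (cong e (trans (sym a+) (cong (a +_) eq))) (right-false a))) λ ())

  -- `g ℓ` is the number of positions kept at the front of a block of length ℓ. By `g-multiple` the
  -- cut respects the period n; by `g-large` at least 2n marked positions precede every cut.
  module Deletion
    (n : ℕ) (1≤n : 1 ≤ n)
    (g : ℕ → ℕ)
    (g-multiple : ∀ ℓ → ∃ λ q → ℓ ≡ g ℓ + q * n)
    (g-large : ∀ ℓ → g ℓ < ℓ → 2 * n ≤ g ℓ)
    where

    g≤ : ∀ ℓ → g ℓ ≤ ℓ
    g≤ ℓ = let (q , eq) = g-multiple ℓ in subst (g ℓ ≤_) (sym eq) (m≤m+n (g ℓ) (q * n))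

    size : ℕ → ℕ
    size i = left i + right i

    del : ℕ → Bool
    del i = e i ∧ does (g (size i) ≤? left i)

    del-true : ∀ i → e i ≡ true → g (size i) ≤ left i → del i ≡ true
    del-true i ei le rewrite ei = dec-true (g (size i) ≤? left i) le

    del-false : ∀ i → left i < g (size i) → del i ≡ false
    del-false i lt with e i
    ... | false = refl
    ... | true  = dec-false (g (size i) ≤? left i) (<⇒≱ lt)

    del-end : ∀ i → e i ≡ false → del i ≡ false
    del-end i ei rewrite ei = refl

    del⇒ : ∀ i → del i ≡ true → e i ≡ true × g (size i) ≤ left i
    del⇒ i di with e i
    ... | true = refl , ≤ᵇ⇒≤ _ _ (subst T (sym di) _)

    kept⇒ : ∀ i → e i ≡ true → del i ≡ false → left i < g (size i)
    kept⇒ i ei di = ≰⇒> λ le → contradiction (trans (sym (del-true i ei le)) di) λ ()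

    del-large : ∀ i → del i ≡ true → 2 * n ≤ left i
    del-large i di = let (ei , le) = del⇒ i di in
      ≤-trans (g-large (size i) (≤-<-trans le (m<m+n (left i) (right-pos i ei)))) le

    kept-near : ∀ i → left i < 2 * n → del i ≡ false
    kept-near i lt = ¬-not λ di → <⇒≱ lt (del-large i di)

    kept-start : ∀ a → left a ≡ 0 → del a ≡ false
    kept-start a la = kept-near a (subst (_< 2 * n) (sym la) (≤-trans 1≤n (m≤m+n n _)))

    -- A run covers n letters more than it has marked positions. This lemma protects those last
    -- letters, which begin at the unmarked position closing the block.
    kept-after-false : ∀ z h → e z ≡ false → h ≤ 2 * n → del (z + h) ≡ false
    kept-after-false z zero    ez h≤ = del-end _ (trans (cong e (+-identityʳ z)) ez)
    kept-after-false z (suc h) ez h≤ = trans (cong del (+-suc z h))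
      (kept-near (suc z + h) (≤-<-trans (left-after-false z h ez) h≤))

    size-suc : ∀ i → e i ≡ true → size (suc i) ≡ size i
    size-suc i ei = begin
      left (suc i) + right (suc i)    ≡⟨ cong (_+ right (suc i)) (left-true i ei) ⟩
      suc (left i + right (suc i))    ≡⟨ sym (+-suc (left i) _) ⟩
      left i + suc (right (suc i))    ≡⟨ cong (left i +_) (sym (right-suc i ei)) ⟩
      left i + right i                ∎
      where open ≡-Reasoning

    del-suc : ∀ i → del i ≡ true → e (suc i) ≡ true → del (suc i) ≡ true
    del-suc i di ei′ = let (ei , le) = del⇒ i di in del-true (suc i) ei′
      (subst₂ _≤_ (cong g (sym (size-suc i ei))) (sym (left-true i ei)) (m≤n⇒m≤1+n le))

    size-+ : ∀ h a → left a ≡ 0 → h ≤ right a → size (a + h) ≡ right a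
    size-+ h a la h≤ = trans (cong (_+ right (a + h)) (left-+ h a la h≤)) (right-+ h a h≤)

    del-block : ∀ h a → left a ≡ 0 → h < right a → g (right a) ≤ h → del (a + h) ≡ true
    del-block h a la h< le = del-true (a + h) (right-true a h h<)
      (subst₂ _≤_ (cong g (sym (size-+ h a la (<⇒≤ h<)))) (sym (left-+ h a la (<⇒≤ h<))) le)

    kept-block : ∀ h a → left a ≡ 0 → h < g (right a) → del (a + h) ≡ false
    kept-block h a la lt = del-false (a + h)
      (subst₂ _<_ (sym (left-+ h a la h≤)) (cong g (sym (size-+ h a la h≤))) lt)
      where h≤ = ≤-trans (<⇒≤ lt) (g≤ (right a))

    skip : ℕ → ℕ
    skip i = if del i then i + right i else i

    skip-kept : ∀ i → del i ≡ false → skip i ≡ i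
    skip-kept i di rewrite di = refl

    skip-del : ∀ i → del i ≡ true → skip i ≡ i + right i
    skip-del i di rewrite di = refl

    -- The increasing enumeration of the kept positions: from a deleted position one passes on to
    -- the unmarked position closing its block.
    φ : ℕ → ℕ
    φ zero    = zero
    φ (suc j) = skip (suc (φ j))

    kept-skip : ∀ i → del (skip i) ≡ false
    kept-skip i = byCase (del i) refl
      where
      byCase : ∀ b → del i ≡ b → del (skip i) ≡ false
      byCase false di = trans (cong del (skip-kept i di)) di
      byCase true  di = trans (cong del (skip-del i di)) (del-end _ (right-false i))

    kept-φ : ∀ j → del (φ j) ≡ false
    kept-φ zero    = kept-start 0 refl
    kept-φ (suc j) = kept-skip (suc (φ j))

    skip-≥ : ∀ i → i ≤ skip i
    skip-≥ i with del i
    ... | true  = m≤m+n i (right i)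
    ... | false = ≤-refl

    φ-mono : ∀ d j → d + φ j ≤ φ (d + j)
    φ-mono zero    j = ≤-refl
    φ-mono (suc d) j = ≤-trans (s≤s (φ-mono d j)) (skip-≥ _)

    φ-strict : ∀ m m′ j → m < m′ → φ (m + j) < φ (m′ + j)
    φ-strict m m′ j lt with m≤n⇒∃[o]m+o≡n lt
    ... | d , refl = ≤-trans (s≤s (≤-trans (m≤n+m (φ (m + j)) d) (φ-mono d (m + j))))
      (≤-trans (skip-≥ _) (≤-reflexive (cong (φ ∘ suc) (trans (sym (+-assoc d m j)) (cong (_+ j) (+-comm d m))))))

    φ-injective : ∀ m m′ j → φ (m + j) ≡ φ (m′ + j) → m ≡ m′
    φ-injective m m′ j eq with <-cmp m m′
    ... | tri< lt _ _    = contradiction eq (<⇒≢ (φ-strict m m′ j lt))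
    ... | tri≈ _ m≡m′ _ = m≡m′
    ... | tri> _ _ gt    = contradiction (sym eq) (<⇒≢ (φ-strict m′ m j gt))

    skip-suc : ∀ i → del i ≡ true → skip i ≡ skip (suc i)
    skip-suc i di = byCase (del (suc i)) refl
      where
      ei : e i ≡ true
      ei = proj₁ (del⇒ i di)
      skip-i : skip i ≡ suc i + right (suc i)
      skip-i = trans (skip-del i di) (trans (cong (i +_) (right-suc i ei)) (+-suc i _))
      byCase : ∀ b → del (suc i) ≡ b → skip i ≡ skip (suc i)
      byCase true  di′ = trans skip-i (sym (skip-del (suc i) di′))
      byCase false di′ = trans skip-i (trans
        (cong (suc i +_) (right-zero (suc i) (¬-not λ ei′ → contradiction (trans (sym (del-suc i di ei′)) di′) λ ())))
        (trans (+-identityʳ (suc i)) (sym (skip-kept (suc i) di′))))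

    -- Passes from an interval of x to a factor of the reduced word. The invariant makes `φ (m + j)`
    -- the first kept position not before `φ j + d`. With f quantified inside, the same m serves for
    -- x and for its translate by n.
    gather-φ : ∀ j d → ∃ λ m → φ (m + j) ≡ skip (φ j + d) ×
      (∀ {A : Set} (f : ℕ → A) → gather del f (φ j) d ≡ seg (f ∘ φ) j m)
    gather-φ j zero = 0 , trans (sym (skip-kept (φ j) (kept-φ j))) (cong skip (sym (+-identityʳ (φ j)))) , λ f → refl
    gather-φ j (suc d) with gather-φ j d
    ... | m , eq , seg-eq = byCase (del (φ j + d)) refl
      where
      byCase : ∀ b → del (φ j + d) ≡ b → ∃ λ m → φ (m + j) ≡ skip (φ j + suc d) ×
        (∀ {A : Set} (f : ℕ → A) → gather del f (φ j) (suc d) ≡ seg (f ∘ φ) j m)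
      byCase true di = m ,
        trans eq (trans (skip-suc _ di) (cong skip (sym (+-suc (φ j) d)))) ,
        λ f → trans (gather-snoc-skip del f (φ j) d di) (seg-eq f)
      byCase false di = suc m ,
        trans (cong (skip ∘ suc) at) (cong skip (sym (+-suc (φ j) d))) ,
        λ f → trans (gather-snoc-keep del f (φ j) d di) (trans
          (cong₂ _∷ʳ_ (seg-eq f) (cong f (trans (sym at) (cong φ (+-comm m j)))))
          (sym (seg-snoc (f ∘ φ) j m)))
        where
        at : φ (m + j) ≡ φ j + d
        at = trans eq (skip-kept _ di)

    seg-φ : ∀ j m → ∃ λ d → φ j + d ≡ φ (m + j) × (∀ {A : Set} (f : ℕ → A) → seg (f ∘ φ) j m ≡ gather del f (φ j) d)
    seg-φ j m with m≤n⇒∃[o]m+o≡n (≤-trans (m≤n+m (φ j) m) (φ-mono m j))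
    ... | d , eq with gather-φ j d
    ...   | m′ , at , seg-eq = d , eq , λ f → trans (cong (seg (f ∘ φ) j) (sym m′≡m)) (sym (seg-eq f))
      where
      m′≡m : m′ ≡ m
      m′≡m = φ-injective m′ m j (trans at (trans (cong skip eq) (skip-kept _ (kept-φ (m + j)))))

    kept-surjective : ∀ i → del i ≡ false → ∃ λ j → φ j ≡ i
    kept-surjective i di = let (m , eq , _) = gather-φ 0 i in m + 0 , trans eq (skip-kept i di)

    φ-run : ∀ j → left (φ j) ≡ 0 → ∀ h → h < g (right (φ j)) → φ (h + j) ≡ φ j + h
    φ-run j lj zero    h< = sym (+-identityʳ (φ j))
    φ-run j lj (suc h) h< = begin
      skip (suc (φ (h + j)))   ≡⟨ cong (skip ∘ suc) (φ-run j lj h (<⇒≤ h<)) ⟩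
      skip (suc (φ j + h))     ≡⟨ cong skip (sym (+-suc (φ j) h)) ⟩
      skip (φ j + suc h)       ≡⟨ skip-kept _ (kept-block (suc h) (φ j) lj h<) ⟩
      φ j + suc h              ∎
      where open ≡-Reasoning

    φ-end : ∀ j → left (φ j) ≡ 0 → φ (g (right (φ j)) + j) ≡ φ j + right (φ j)
    φ-end j lj = byCase (g (right (φ j))) refl
      where
      a = φ j
      byCase : ∀ G → g (right a) ≡ G → φ (G + j) ≡ a + right a
      -- Only the empty block can keep nothing, as a shortened block keeps at least 2n positions.
      byCase zero eq = sym (trans (cong (a +_) (n≤0⇒n≡0 (≮⇒≥ λ 0< →
        <⇒≱ (≤-trans 1≤n (m≤m+n n _)) (≤-trans (g-large (right a) (subst (_< right a) (sym eq) 0<)) (≤-reflexive eq)))))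
        (+-identityʳ a))
      byCase (suc G) eq = trans (cong (skip ∘ suc) (φ-run j lj G (≤-reflexive (sym eq))))
        (trans (cong skip (sym (+-suc a G))) finish)
        where
        G≤ : suc G ≤ right a
        G≤ = subst (_≤ right a) eq (g≤ (right a))
        finish : skip (a + suc G) ≡ a + right a
        finish with m≤n⇒m<n∨m≡n G≤
        ... | inj₁ lt = trans (skip-del _ (del-block (suc G) a lj lt (≤-reflexive eq)))
                (trans (+-assoc a (suc G) _) (cong (a +_) (right-+ (suc G) a G≤)))
        ... | inj₂ eq′ = trans (skip-kept _ (del-end _ (trans (cong (λ k → e (a + k)) eq′) (right-false a))))
                (cong (a +_) eq′)

    φ-next : ∀ j → left (φ j) ≡ 0 → φ (suc (g (right (φ j))) + j) ≡ suc (φ j + right (φ j))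
    φ-next j lj = trans (cong (skip ∘ suc) (φ-end j lj)) (skip-kept _ (kept-start _ (left-false _ (right-false (φ j)))))

-- The reduced word and its mirror symmetry

module Reduced
  (e : ℕ → Bool) (right : ℕ → ℕ)
  (right-true : ∀ i h → h < right i → e (i + h) ≡ true)
  (right-false : ∀ i → e (i + right i) ≡ false)
  (n : ℕ) (1≤n : 1 ≤ n)
  (g : ℕ → ℕ)
  (g-multiple : ∀ ℓ → ∃ λ q → ℓ ≡ g ℓ + q * n)
  (g-large : ∀ ℓ → g ℓ < ℓ → 2 * n ≤ g ℓ)
  {A : Set} (x : InfiniteWord A)
  (period : ∀ i → e i ≡ true → x (i + n) ≡ x i)
  where

  open Blocks e right right-true right-false public
  open Deletion n 1≤n g g-multiple g-large public

  x̄ : InfiniteWord A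
  x̄ = x ∘ φ

  n≤2n : n ≤ 2 * n
  n≤2n = m≤m+n n _

  -- The bound is m + n because m consecutive marked positions cover m + n letters of the run.
  shift : ∀ s m → (∀ h → h < m → e (s + h) ≡ true) →
    ∀ q h → h + q * n < m + n → x (s + (h + q * n)) ≡ x (s + h)
  shift s m tr zero    h lt = cong (λ k → x (s + k)) (+-identityʳ h)
  shift s m tr (suc q) h lt = begin
    x (s + (h + (n + q * n)))   ≡⟨ cong x (assoc s h n (q * n)) ⟩
    x (s + (h + q * n) + n)     ≡⟨ period _ (tr _ lt′) ⟩
    x (s + (h + q * n))         ≡⟨ shift s m tr q h (≤-trans lt′ (m≤m+n m n)) ⟩
    x (s + h)                   ∎
    where
    open ≡-Reasoning
    assoc : ∀ s h n k → s + (h + (n + k)) ≡ s + (h + k) + n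
    assoc = solve-∀
    assoc′ : ∀ h n k → h + (n + k) ≡ h + k + n
    assoc′ = solve-∀
    lt′ : h + q * n < m
    lt′ = +-cancelʳ-< n _ m (subst (_< m + n) (assoc′ h n (q * n)) lt)

  firstDeleted : ∀ j → del (suc (φ j)) ≡ true → left (suc (φ j)) ≡ g (size (suc (φ j)))
  firstDeleted j di = byCase (e (φ j)) refl
    where
    byCase : ∀ b → e (φ j) ≡ b → left (suc (φ j)) ≡ g (size (suc (φ j)))
    byCase false ei = contradiction
      (trans (sym di) (kept-near _ (subst (_< 2 * n) (sym (left-false _ ei)) (≤-trans 1≤n n≤2n)))) λ ()
    byCase true ei = ≤-antisym
      (subst₂ _≤_ (sym (left-true _ ei)) (cong g (sym (size-suc _ ei))) (kept⇒ _ ei (kept-φ j)))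
      (proj₂ (del⇒ _ di))

  -- A cut removes a multiple of n positions at the end of a block, and the period persists for n
  -- letters from the closing position on. So the n letters behind the cut equal those that stood at
  -- its beginning.
  jump : ∀ j h → h < n → x (φ (suc j) + h) ≡ x (suc (φ j) + h)
  jump j h h<n = byCase (del i) refl
    where
    i = suc (φ j)
    byCase : ∀ b → del i ≡ b → x (skip i + h) ≡ x (i + h)
    byCase false di = cong (λ k → x (k + h)) (skip-kept i di)
    byCase true di with g-multiple (size i)
    ... | q , eq = begin
      x (skip i + h)        ≡⟨ cong (λ k → x (k + h)) (skip-del i di) ⟩
      x (i + right i + h)   ≡⟨ cong x (trans (+-assoc i _ h) (cong (i +_) (+-comm _ h))) ⟩
      x (i + (h + right i)) ≡⟨ cong (λ k → x (i + (h + k))) r≡ ⟩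
      x (i + (h + q * n))   ≡⟨ shift i (right i) (right-true i) q h
                                 (subst (λ k → h + k < right i + n) r≡ (subst (h + right i <_) (+-comm n _) (+-monoˡ-< (right i) h<n))) ⟩
      x (i + h)             ∎
      where
      open ≡-Reasoning
      r≡ : right i ≡ q * n
      r≡ = +-cancelˡ-≡ (left i) _ _ (trans eq (cong (_+ q * n) (sym (firstDeleted j di))))

  -- Induction on h with j varying: each step of φ may cross a cut, and `jump` carries the next n
  -- letters over it.
  window : ∀ h j → h ≤ n → x̄ (h + j) ≡ x (φ j + h)
  window zero    j h≤ = cong x (sym (+-identityʳ (φ j)))
  window (suc h) j h≤ = begin
    x̄ (suc (h + j))       ≡⟨ cong x̄ (sym (+-suc h j)) ⟩
    x̄ (h + suc j)         ≡⟨ window h (suc j) (<⇒≤ h≤) ⟩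
    x (φ (suc j) + h)      ≡⟨ jump j h h≤ ⟩
    x (suc (φ j) + h)      ≡⟨ cong x (sym (+-suc (φ j) h)) ⟩
    x (φ j + suc h)        ∎
    where open ≡-Reasoning

  -- Inside a block the deleted positions come last, so what remains of a marked stretch is a prefix
  -- of it and thus a single factor of x.
  stretch : ∀ s m → m ≤ right s → ∃ λ h → gather del x s m ≡ seg x s h
  stretch s zero    m≤ = 0 , refl
  stretch s (suc m) m≤ = byCase (del s) refl
    where
    es : e s ≡ true
    es = pos-right s (≤-trans z<s m≤)
    m≤′ : m ≤ right (suc s)
    m≤′ = s≤s⁻¹ (subst (suc m ≤_) (right-suc s es) m≤)
    gone : ∀ s m → del s ≡ true → suc m ≤ right s → gather del x s (suc m) ≡ []
    gone s zero    ds m≤ = gather-skip del x s 0 ds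
    gone s (suc m) ds m≤ = trans (gather-skip del x s (suc m) ds)
      (gone (suc s) m (del-suc s ds (pos-right (suc s) (≤-trans z<s m≤″))) m≤″)
      where
      m≤″ : suc m ≤ right (suc s)
      m≤″ = s≤s⁻¹ (subst (suc (suc m) ≤_) (right-suc s (proj₁ (del⇒ s ds))) m≤)
    byCase : ∀ b → del s ≡ b → ∃ λ h → gather del x s (suc m) ≡ seg x s h
    byCase true  ds = 0 , gone s m ds m≤
    byCase false ds = let (h , eq) = stretch (suc s) m m≤′ in
      suc h , trans (gather-keep del x s m ds) (cong (x s ∷_) eq)

  -- Letters are reflected by i ↦ L + n - i, but marks by i ↦ L - i, since a mark sits at the left
  -- end of its window. `x⁺` and `shifted` make up for the offset n between the two reflections.
  module Symmetric
    (z L : ℕ) (ez : e z ≡ false)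
    (pal : ∀ i j → i + j ≡ L + n → x (z + i) ≡ x (z + j))
    (e-sym : ∀ i j → i + j ≡ L → e (z + i) ≡ e (z + j))
    where

    -- The deletion reflected at the centre of [z, z + L]: it removes the first positions of a block
    -- instead of the last.
    del′ : ℕ → Bool
    del′ t = del ((z + (z + L)) ∸ t)

    del′-mirror : ∀ i j → i + j ≡ L → del′ (z + i) ≡ del (z + j)
    del′-mirror i j refl = cong del (trans (cong (_∸ (z + i)) (shape z i j)) (m+n∸n≡m (z + j) (z + i)))
      where
      shape : ∀ z i j → z + (z + (i + j)) ≡ z + j + (z + i)
      shape = solve-∀

    e-end : e (z + L) ≡ false
    e-end = trans (e-sym L 0 (+-identityʳ L)) (trans (cong e (+-identityʳ z)) ez)

    -- Within a block, deleting the first and deleting the last positions leaves the same word,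
    -- since the number of deleted positions is a multiple of n.
    block : ∀ i ℓ m → suc i + (ℓ + m) ≡ L → right (suc (z + i)) ≡ ℓ → e (z + i) ≡ false →
      gather del x (suc (z + i)) ℓ ≡ gather del′ x (suc (z + i)) ℓ
    block i ℓ m sum refl ei with g-multiple ℓ
    ... | q , eq = begin
      gather del x a ℓ                                   ≡⟨ cong (gather del x a) eq ⟩
      gather del x a (G + q * n)                         ≡⟨ gather-split del x a G (q * n) ⟩
      gather del x a G ++ gather del x (a + G) (q * n)   ≡⟨ cong₂ _++_
          (gather-none del x a G λ h h<G → kept-block h a la h<G)
          (gather-all del x (a + G) (q * n) λ h h<q → trans (cong del (+-assoc a G h))
             (del-block (G + h) a la (subst (G + h <_) (sym eq) (+-monoʳ-< G h<q)) (m≤m+n G h))) ⟩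
      seg x a G ++ []                                    ≡⟨ ++-identityʳ _ ⟩
      seg x a G                                          ≡⟨ sym (seg-cong x x (a + q * n) a G λ h h<G →
          trans (cong x (trans (+-assoc a (q * n) h) (cong (a +_) (+-comm (q * n) h))))
            (shift a ℓ (right-true a) q h (≤-trans (subst (h + q * n <_) (sym eq) (+-monoˡ-< (q * n) h<G)) (m≤m+n ℓ n)))) ⟩
      seg x (a + q * n) G                                ≡⟨ sym (cong₂ _++_
          (gather-all del′ x a (q * n) first)
          (gather-none del′ x (a + q * n) G last)) ⟩
      gather del′ x a (q * n) ++ gather del′ x (a + q * n) G ≡⟨ sym (gather-split del′ x a (q * n) G) ⟩
      gather del′ x a (q * n + G)                        ≡⟨ cong (gather del′ x a) (trans (+-comm (q * n) G) (sym eq)) ⟩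
      gather del′ x a ℓ                                  ∎
      where
      open ≡-Reasoning
      a  = suc (z + i)
      a′ = suc (z + m)
      G = g ℓ
      la : left a ≡ 0
      la = left-false _ ei
      shape₁ : ∀ m i ℓ → m + (suc i + ℓ) ≡ suc i + (ℓ + m)
      shape₁ = solve-∀
      shape₂ : ∀ m ℓ i → (suc m + ℓ) + i ≡ suc i + (ℓ + m)
      shape₂ = solve-∀
      shape₃ : ∀ m i h h′ → (suc m + h) + (suc i + h′) ≡ suc i + (suc (h + h′) + m)
      shape₃ = solve-∀
      a+ : ∀ z i h → z + (suc i + h) ≡ suc (z + i) + h
      a+ = solve-∀
      em : e (z + m) ≡ false
      em = trans (e-sym m (suc i + ℓ) (trans (shape₁ m i ℓ) sum))
             (trans (cong e (a+ z i ℓ)) (right-false a))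
      la′ : left a′ ≡ 0
      la′ = left-false _ em
      r′ : right a′ ≡ ℓ
      r′ = right-unique a′ ℓ
        (λ h h<ℓ → case m≤n⇒∃[o]m+o≡n h<ℓ of λ where
          (h′ , ℓ≡) → trans (cong e (sym (a+ z m h))) (trans
            (e-sym (suc m + h) (suc i + h′) (trans (shape₃ m i h h′) (trans (cong (λ k → suc i + (k + m)) ℓ≡) sum)))
            (trans (cong e (a+ z i h′)) (right-true a h′ (≤-trans (s≤s (m≤n+m h′ h)) (≤-reflexive ℓ≡))))))
        (trans (cong e (sym (a+ z m ℓ))) (trans (e-sym (suc m + ℓ) i (trans (shape₂ m ℓ i) sum)) ei))
      mirror : ∀ h h′ → suc (h + h′) ≡ ℓ → del′ (a + h) ≡ del (a′ + h′)
      mirror h h′ ℓ≡ = trans (cong del′ (sym (a+ z i h))) (trans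
        (del′-mirror (suc i + h) (suc m + h′)
          (trans (+-comm (suc i + h) _) (trans (shape₃ m i h′ h) (trans (cong (λ k → suc i + (suc k + m)) (+-comm h′ h))
            (trans (cong (λ k → suc i + (k + m)) ℓ≡) sum)))))
        (cong del (a+ z m h′)))
      first : ∀ h → h < q * n → del′ (a + h) ≡ true
      first h h<q with m≤n⇒∃[o]m+o≡n h<q
      ... | o , q≡ = trans (mirror h (G + o) ℓ≡)
        (del-block (G + o) a′ la′ (subst (G + o <_) (sym r′) (≤-trans (s≤s (m≤n+m (G + o) h)) (≤-reflexive ℓ≡)))
          (subst (λ k → g k ≤ G + o) (sym r′) (m≤m+n G o)))
        where
        shape : ∀ h G o → suc (h + (G + o)) ≡ G + (suc h + o)
        shape = solve-∀
        ℓ≡ : suc (h + (G + o)) ≡ ℓ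
        ℓ≡ = trans (shape h G o) (trans (cong (G +_) q≡) (sym eq))
      last : ∀ h → h < G → del′ (a + q * n + h) ≡ false
      last h h<G with m≤n⇒∃[o]m+o≡n h<G
      ... | o , G≡ = trans (cong del′ (+-assoc a (q * n) h)) (trans (mirror (q * n + h) o ℓ≡)
        (kept-block o a′ la′ (subst (λ k → o < g k) (sym r′) (≤-trans (s≤s (m≤n+m o h)) (≤-reflexive G≡)))))
        where
        shape : ∀ k h o → suc (k + h + o) ≡ (suc h + o) + k
        shape = solve-∀
        ℓ≡ : suc (q * n + h + o) ≡ ℓ
        ℓ≡ = trans (shape (q * n) h o) (trans (cong (_+ q * n) G≡) (sym eq))

    -- Walks from one unmarked position to the next and compares whole blocks by `block`; `fuel`
    -- bounds the remaining length, since a step jumps over an entire block.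
    mirrored-from : ∀ fuel m → m ≤ fuel → ∀ i → i + m ≡ L → e (z + i) ≡ false →
      gather del x (z + i) (suc m) ≡ gather del′ x (z + i) (suc m)
    mirrored-from fuel m m≤ i sum ei = begin
      gather del x (z + i) (suc m)              ≡⟨ gather-keep del x _ m (del-end _ ei) ⟩
      x (z + i) ∷ gather del x (suc (z + i)) m  ≡⟨ cong (x (z + i) ∷_) (rest fuel m m≤ sum) ⟩
      x (z + i) ∷ gather del′ x (suc (z + i)) m ≡⟨ sym (gather-keep del′ x _ m
          (trans (del′-mirror i m sum) (del-end _ (trans (sym (e-sym i m sum)) ei)))) ⟩
      gather del′ x (z + i) (suc m)             ∎
      where
      open ≡-Reasoning
      rest : ∀ fuel m → m ≤ fuel → i + m ≡ L →
        gather del x (suc (z + i)) m ≡ gather del′ x (suc (z + i)) m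
      rest fuel       zero    m≤ sum = refl
      rest (suc fuel) (suc m) (s≤s m≤) sum with m≤n⇒∃[o]m+o≡n (right-≤ (suc (z + i)) m
        (trans (cong e (trans (sym (+-suc (z + i) m)) (trans (+-assoc z i (suc m)) (cong (z +_) sum)))) e-end))
      ... | m′ , refl = begin
        gather del x a (suc (ℓ + m′))      ≡⟨ cong (gather del x a) (sym (+-suc ℓ m′)) ⟩
        gather del x a (ℓ + suc m′)        ≡⟨ gather-split del x a ℓ (suc m′) ⟩
        gather del x a ℓ ++ gather del x (a + ℓ) (suc m′)
          ≡⟨ cong₂ _++_ (block i ℓ m′ (trans (sym (+-suc i _)) sum) refl ei)
               (subst (λ k → gather del x k (suc m′) ≡ gather del′ x k (suc m′)) (a+ z i ℓ)
                 (mirrored-from fuel m′ (≤-trans (m≤n+m m′ ℓ) m≤) (suc i + ℓ)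
                   (trans (assoc i ℓ m′) sum) (trans (cong e (a+ z i ℓ)) (right-false a)))) ⟩
        gather del′ x a ℓ ++ gather del′ x (a + ℓ) (suc m′) ≡⟨ sym (gather-split del′ x a ℓ (suc m′)) ⟩
        gather del′ x a (ℓ + suc m′)       ≡⟨ cong (gather del′ x a) (+-suc ℓ m′) ⟩
        gather del′ x a (suc (ℓ + m′))     ∎
        where
        a = suc (z + i)
        ℓ = right a
        a+ : ∀ z i h → z + (suc i + h) ≡ suc (z + i) + h
        a+ = solve-∀
        assoc : ∀ i ℓ m → suc i + ℓ + m ≡ i + suc (ℓ + m)
        assoc = solve-∀

    mirrored : gather del x z (suc L) ≡ gather del′ x z (suc L)
    mirrored = subst (λ k → gather del x k (suc L) ≡ gather del′ x k (suc L)) (+-identityʳ z)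
      (mirrored-from L L ≤-refl 0 refl (trans (cong e (+-identityʳ z)) ez))

    x⁺ : ℕ → A
    x⁺ i = x (i + n)

    tail : seg x (z + suc L) n ≡ gather del x (z + suc L) n
    tail = sym (gather-none del x (z + suc L) n λ h h<n → trans (cong del (assoc z L h))
      (kept-after-false (z + L) (suc h) e-end (≤-trans h<n n≤2n)))
      where
      assoc : ∀ z L h → z + suc L + h ≡ (z + L) + suc h
      assoc = solve-∀

    -- Both sides are the same factor of x̄, of length m + n, divided after m or after n letters.
    -- `window` turns its last m letters into letters of x read n places beyond the kept positions.
    shifted : gather del x z (suc L) ++ seg x (z + suc L) n ≡ seg x z n ++ gather del x⁺ z (suc L)
    shifted with kept-surjective z (del-end z ez)
    ... | j , refl with gather-φ j (suc L)
    ...   | m , at , seg-eq = begin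
      gather del x z′ (suc L) ++ seg x (z′ + suc L) n  ≡⟨ cong₂ _++_ (seg-eq x) (seg-cong x x̄ _ (j + m) n λ h h<n →
          trans (cong (λ k → x (k + h)) (sym at′)) (trans (sym (window h (m + j) (<⇒≤ h<n))) (cong x̄ (shape₁ h m j)))) ⟩
      seg x̄ j m ++ seg x̄ (j + m) n                     ≡⟨ sym (seg-split x̄ j m n) ⟩
      seg x̄ j (m + n)                                    ≡⟨ cong (seg x̄ j) (+-comm m n) ⟩
      seg x̄ j (n + m)                                    ≡⟨ seg-split x̄ j n m ⟩
      seg x̄ j n ++ seg x̄ (j + n) m                      ≡⟨ cong₂ _++_
          (seg-cong x̄ x j z′ n λ h h<n → trans (cong x̄ (+-comm j h)) (window h j (<⇒≤ h<n)))
          (seg-cong x̄ (x⁺ ∘ φ) (j + n) j m λ h h<m → trans (cong x̄ (shape₂ j n h)) (window n (j + h) ≤-refl)) ⟩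
      seg x z′ n ++ seg (x⁺ ∘ φ) j m                      ≡⟨ cong (seg x z′ n ++_) (sym (seg-eq x⁺)) ⟩
      seg x z′ n ++ gather del x⁺ z′ (suc L)              ∎
      where
      open ≡-Reasoning
      z′ = φ j
      at′ : φ (m + j) ≡ z′ + suc L
      at′ = trans at (skip-kept _ (kept-start _ (trans (cong left (+-suc z′ L)) (left-false _ e-end))))
      shape₁ : ∀ h m j → h + (m + j) ≡ j + m + h
      shape₁ = solve-∀
      shape₂ : ∀ j n h → j + n + h ≡ n + (j + h)
      shape₂ = solve-∀

    -- Reversal turns the letters `x⁺` under `del` into the letters of x under `del′`, and
    -- `mirrored` exchanges `del′` for `del` again.
    reduced-palindrome : gather del x z (suc L + n) ≡ reverse (gather del x z (suc L + n))
    reduced-palindrome = sym (begin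
      reverse (gather del x z (suc L + n))                        ≡⟨ cong reverse whole ⟩
      reverse (gather del x z (suc L) ++ seg x (z + suc L) n)     ≡⟨ cong reverse shifted ⟩
      reverse (seg x z n ++ gather del x⁺ z (suc L))              ≡⟨ reverse-++ (seg x z n) _ ⟩
      reverse (gather del x⁺ z (suc L)) ++ reverse (seg x z n)    ≡⟨ cong₂ _++_
          (sym (trans mirrored (gather-reverse del del′ x⁺ x z z (suc L)
            (λ i j sum → del′-mirror i j (suc-injective sum))
            (λ i j sum → trans (pal i (j + n) (trans (sym (+-assoc i j n)) (cong (_+ n) (suc-injective sum))))
              (cong x (sym (+-assoc z j n)))))))
          (sym (seg-reverse x x z (z + suc L) n λ i j sum → trans (cong x (+-assoc z (suc L) i))
            (pal (suc L + i) j (trans (shape L i j) (cong (L +_) sum))))) ⟩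
      gather del x z (suc L) ++ seg x (z + suc L) n               ≡⟨ sym whole ⟩
      gather del x z (suc L + n)                                  ∎)
      where
      open ≡-Reasoning
      shape : ∀ L i j → suc L + i + j ≡ L + suc (i + j)
      shape = solve-∀
      whole : gather del x z (suc L + n) ≡ gather del x z (suc L) ++ seg x (z + suc L) n
      whole = trans (gather-split del x z (suc L) n) (cong (gather del x z (suc L) ++_) (sym tail))

-- Positions in palindromes and in sequences of blocks

palindrome-at : ∀ (x : ℕ → A) s m → seg x s m ≡ reverse (seg x s m) →
  ∀ i j → suc (i + j) ≡ m → x (s + i) ≡ x (s + j)
palindrome-at x s m pal i j refl =
  trans (seg-at x mirror s 0 m (trans pal (sym (seg-reverse x mirror s 0 m mirror-at))) i (s≤s (m≤m+n i j)))
    (mirror-at i j refl)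
  where
  mirror : ℕ → _
  mirror i = x (s + (m ∸ suc i))
  mirror-at : ∀ i j → suc (i + j) ≡ m → mirror i ≡ x (s + j)
  mirror-at i j eq = cong (λ k → x (s + k)) (trans (cong (_∸ suc i) (sym eq)) (m+n∸m≡n i j))

-- The offset h may equal the length of the block: that is the unmarked position closing it.
locate : ∀ (b c : ℕ → ℕ) → (∀ i → b (suc i) ≡ suc (b i + c i)) →
  ∀ i₁ d → ∃₂ λ i h → b i₁ + d ≡ b (i + i₁) + h × h ≤ c (i + i₁)
locate b c step i₁ zero = 0 , 0 , refl , z≤n
locate b c step i₁ (suc d) with locate b c step i₁ d
... | i , h , eq , h≤ with m≤n⇒m<n∨m≡n h≤
...   | inj₁ h< = i , suc h , trans (+-suc _ d) (trans (cong suc eq) (sym (+-suc _ h))) , h<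
...   | inj₂ refl = suc i , 0 , trans (+-suc _ d) (trans (cong suc eq) (trans (sym (step _)) (sym (+-identityʳ _)))) , z≤n

-- The word x is coded by the lengths of the maximal blocks of positions satisfying e, and by the
-- windows of length n + 1 at the positions ending these blocks.
module Segments
  (e : ℕ → Bool) (right : ℕ → ℕ)
  (right-true : ∀ i h → h < right i → e (i + h) ≡ true)
  (n : ℕ) (1≤n : 1 ≤ n)
  {A : Set} (x : InfiniteWord A)
  (period : ∀ i → e i ≡ true → x (i + n) ≡ x i)
  where

  -- Exactly one unmarked position separates consecutive blocks; adjacent unmarked positions enclose
  -- an empty block.
  start : ℕ → ℕ
  start zero    = 0
  start (suc i) = suc (start i + right (start i))

  gap : ℕ → ℕ
  gap i = right (start i)

  separator : ℕ → List A
  separator i = seg x (start i + gap i) (suc n)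

  code : ℕ → List A × ℕ
  code i = separator i , gap i

  -- Equal codes translate the block starts by a fixed P. The first n letters of a block stand in
  -- the separator before it, and each later one repeats the letter n places earlier, which is at a
  -- marked position.
  EP-code : EventuallyPeriodic code → EventuallyPeriodic x
  -- Block `suc N` instead of N, because its first n letters are read off the separator of block N.
  EP-code (N , r , per) = start (suc N) , proj₁ shiftBy , λ i s≤i →
    case m≤n⇒∃[o]m+o≡n s≤i of λ where
      (d , refl) → case locate start gap (λ _ → refl) (suc N) d of λ where
        (t , h , eq , h≤) → let eq′ = trans eq (cong (λ k → start k + h) (+-suc t N)) in
          trans (cong (λ k → x (P + k)) eq′) (trans
            (inBlock t h (subst (λ k → h ≤ gap k) (+-suc t N) h≤)) (cong x (sym eq′)))
    where
    R = suc r
    start-mono : ∀ d i → d + start i ≤ start (d + i)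
    start-mono zero    i = ≤-refl
    start-mono (suc d) i = s≤s (≤-trans (start-mono d i) (m≤m+n _ _))
    shiftBy : ∃ λ p → suc p + start N ≡ start (R + N)
    shiftBy = let (o , eq) = m≤n⇒∃[o]m+o≡n (start-mono R N) in
      r + o , trans (cong suc (trans (+-assoc r o _) (trans (cong (r +_) (+-comm o _)) (sym (+-assoc r _ o))))) eq
    P = suc (proj₁ shiftBy)
    per′ : ∀ t → code (R + (t + N)) ≡ code (t + N)
    per′ t = per (t + N) (m≤n+m N t)
    aligned : ∀ t → start (R + (t + N)) ≡ P + start (t + N)
    aligned zero = sym (proj₂ shiftBy)
    aligned (suc t) = trans (cong start (+-suc R (t + N))) (trans
      (cong suc (cong₂ _+_ (aligned t) (cong proj₂ (per′ t))))
      (trans (cong suc (+-assoc P _ _)) (sym (+-suc P _))))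
    inBlock : ∀ t h → h ≤ gap (suc t + N) → x (P + (start (suc t + N) + h)) ≡ x (start (suc t + N) + h)
    inBlock t = <-rec _ step
      where
      s = start (suc t + N)
      step : ∀ h → (∀ {h′} → h′ < h → h′ ≤ gap (suc t + N) → x (P + (s + h′)) ≡ x (s + h′)) →
        h ≤ gap (suc t + N) → x (P + (s + h)) ≡ x (s + h)
      step h rec h≤ with n ≤? h
      ... | no n≰h = begin
          x (P + (s + h))                                           ≡⟨ cong x (shape P (start (t + N) + gap (t + N)) h) ⟩
          x (P + (start (t + N) + gap (t + N)) + suc h)             ≡⟨ cong (λ k → x (k + suc h)) (sym (trans
              (cong₂ _+_ (aligned t) (cong proj₂ (per′ t))) (+-assoc P _ _))) ⟩
          x (start (R + (t + N)) + gap (R + (t + N)) + suc h)       ≡⟨ seg-at x x _ _ (suc n) (cong proj₁ (per′ t)) (suc h) (s≤s (≰⇒> n≰h)) ⟩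
          x (start (t + N) + gap (t + N) + suc h)                   ≡⟨ cong x (+-suc _ h) ⟩
          x (s + h)                                                 ∎
        where
        open ≡-Reasoning
        shape : ∀ p a h → p + (suc a + h) ≡ p + a + suc h
        shape = solve-∀
      ... | yes n≤h with m≤n⇒∃[o]m+o≡n n≤h
      ...   | h′ , refl = begin
          x (P + (s + (n + h′)))       ≡⟨ cong x (shape P s n h′) ⟩
          x (P + s + h′ + n)           ≡⟨ period _ (trans (cong (λ k → e (k + h′)) (sym P+s)) (right-true _ h′
                                            (subst (h′ <_) (sym gap≡) h′<))) ⟩
          x (P + s + h′)               ≡⟨ cong x (+-assoc P s h′) ⟩
          x (P + (s + h′))             ≡⟨ rec (m<n+m h′ 1≤n) (<⇒≤ h′<) ⟩
          x (s + h′)                   ≡⟨ sym (period _ (right-true s h′ h′<)) ⟩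
          x (s + h′ + n)               ≡⟨ cong x (shape′ s n h′) ⟩
          x (s + (n + h′))             ∎
        where
        open ≡-Reasoning
        shape : ∀ p s n h → p + (s + (n + h)) ≡ p + s + h + n
        shape = solve-∀
        shape′ : ∀ s n h → s + h + n ≡ s + (n + h)
        shape′ = solve-∀
        h′< : h′ < gap (suc t + N)
        h′< = ≤-trans (m<n+m h′ 1≤n) h≤
        P+s : start (R + (suc t + N)) ≡ P + s
        P+s = aligned (suc t)
        gap≡ : gap (R + (suc t + N)) ≡ gap (suc t + N)
        gap≡ = cong proj₂ (per′ (suc t))

-- Palindromic length, periods and surviving factors of the reduced word

module ReducedWord
  (e : ℕ → Bool) (right : ℕ → ℕ)
  (right-true : ∀ i h → h < right i → e (i + h) ≡ true)
  (right-false : ∀ i → e (i + right i) ≡ false)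
  (n : ℕ) (1≤n : 1 ≤ n)
  (g : ℕ → ℕ)
  (g-multiple : ∀ ℓ → ∃ λ q → ℓ ≡ g ℓ + q * n)
  (g-large : ∀ ℓ → g ℓ < ℓ → 2 * n ≤ g ℓ)
  {A : Set} (x : InfiniteWord A)
  (period : ∀ i → e i ≡ true → x (i + n) ≡ x i)
  (e-local : ∀ i j → (∀ h → h ≤ n → x (i + h) ≡ x (j + h)) → e i ≡ e j)
  (e-mirror : ∀ i j → (∀ h h′ → h + h′ ≡ n → x (i + h) ≡ x (j + h′)) → e i ≡ e j)
  where

  open Reduced e right right-true right-false n 1≤n g g-multiple g-large x period public
  open Segments e right right-true n 1≤n x period public

  module PalindromicLength (k : ℕ) (factor : ∀ s m → PalLength≤ (seg x s m) k) where

    -- k for the marked positions at the front of a palindrome, 1 for its middle, k + k for its end.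
    c : ℕ
    c = k + (1 + (k + k))

    -- One factor of x comes from the marked positions, a second one from the at most n positions
    -- behind them, which are all kept.
    nearlyTrue : ∀ s m → m ≤ right s + n → PalLength≤ (gather del x s m) (k + k)
    nearlyTrue s m m≤ with ≤-total m (right s)
    ... | inj₁ m≤r = let (h , eq) = stretch s m m≤r in
      PalLength≤-mono (m≤m+n k k) (subst (λ w → PalLength≤ w k) (sym eq) (factor s h))
    ... | inj₂ r≤m with m≤n⇒∃[o]m+o≡n r≤m
    ...   | o , refl = let (h , eq) = stretch s r ≤-refl in
      subst (λ w → PalLength≤ w (k + k)) (sym (gather-split del x s r o)) (PalLength≤-++
        (subst (λ w → PalLength≤ w k) (sym eq) (factor s h))
        (subst (λ w → PalLength≤ w k) (sym (gather-none del x (s + r) o λ h h<o →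
          kept-after-false (s + r) h (right-false s) (≤-trans (<⇒≤ h<o) (≤-trans (+-cancelˡ-≤ r o n m≤) n≤2n)))) (factor (s + r) o)))
      where r = right s

    -- If the palindrome outlasts the run at s, its first unmarked window and the mirror image of
    -- that window delimit a middle part to which `Symmetric` applies. Only the two outer parts, of
    -- length `right s` each, lose their symmetry.
    palindrome : ∀ s m → (∀ i j → suc (i + j) ≡ m → x (s + i) ≡ x (s + j)) → PalLength≤ (gather del x s m) c
    palindrome s m pal with m ≤? right s + n
    ... | yes m≤ = PalLength≤-mono (m≤n⇒m≤o+n k (n≤1+n _)) (nearlyTrue s m m≤)
    ... | no m≰ with m≤n⇒∃[o]m+o≡n (≰⇒> m≰)
    ...   | m′ , refl with m≤n⇒∃[o]m+o≡n (right-≤ s m′ em′)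
      where
      shape : ∀ r m′ h h′ → suc ((m′ + h) + (r + h′)) ≡ suc (r + (h + h′)) + m′
      shape = solve-∀
      em′ : e (s + m′) ≡ false
      em′ = trans (e-mirror (s + m′) (s + right s) λ h h′ sum →
        trans (cong x (+-assoc s m′ h)) (trans
          (pal (m′ + h) (right s + h′) (trans (shape (right s) m′ h h′) (cong (λ k → suc (right s + k) + m′) sum)))
          (cong x (sym (+-assoc s (right s) h′))))) (right-false s)
    ...     | L , refl = subst (λ w → PalLength≤ w c) (sym pieces)
      (PalLength≤-++ (subst (λ w → PalLength≤ w k) (sym (proj₂ first)) (factor s _))
        (PalLength≤-++ (PalLength≤-pal reduced-palindrome) (nearlyTrue s′ r (≮⇒≥ noFalse))))
      where
      r = right s
      z = s + r
      s′ = z + (suc L + n)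
      first = stretch s r ≤-refl
      pal′ : ∀ i j → suc (i + j) ≡ suc (r + n) + (r + L) → x (s + i) ≡ x (s + j)
      pal′ = pal
      shape₁ : ∀ r n L → suc (r + n) + (r + L) ≡ r + ((suc L + n) + r)
      shape₁ = solve-∀
      shape₂ : ∀ r i j → suc ((r + i) + (r + j)) ≡ suc (r + (i + j) + r)
      shape₂ = solve-∀
      shape₃ : ∀ r n L → suc (r + (L + n) + r) ≡ suc (r + n) + (r + L)
      shape₃ = solve-∀
      shape₄ : ∀ r i j h h′ → suc ((r + (i + h)) + (r + (j + h′))) ≡ suc (r + ((i + j) + (h + h′)) + r)
      shape₄ = solve-∀
      assoc₃ : ∀ s r i h → s + r + i + h ≡ s + (r + (i + h))
      assoc₃ = solve-∀
      module M = Symmetric z L (right-false s)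
        (λ i j sum → trans (cong x (+-assoc s r i)) (trans
          (pal′ (r + i) (r + j) (trans (shape₂ r i j) (trans (cong (λ k → suc (r + k + r)) sum) (shape₃ r n L))))
          (cong x (sym (+-assoc s r j)))))
        (λ i j sum → e-mirror (z + i) (z + j) λ h h′ sum′ →
          trans (cong x (assoc₃ s r i h)) (trans
            (pal′ (r + (i + h)) (r + (j + h′)) (trans (shape₄ r i j h h′)
              (trans (cong₂ (λ k k′ → suc (r + (k + k′) + r)) sum sum′) (shape₃ r n L))))
            (cong x (sym (assoc₃ s r j h′)))))
      reduced-palindrome = M.reduced-palindrome
      pieces : gather del x s (suc (r + n) + (r + L)) ≡ gather del x s r ++ gather del x z (suc L + n) ++ gather del x s′ r
      pieces = trans (cong (gather del x s) (shape₁ r n L)) (trans (gather-split del x s r _)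
        (cong (gather del x s r ++_) (gather-split del x z (suc L + n) r)))
      noFalse : ¬ (right s′ + n < r)
      -- An unmarked position this early in the end part has its whole window inside the palindrome,
      -- so it mirrors to an unmarked position among the first r, which are all marked.
      noFalse lt with m≤n⇒∃[o]m+o≡n lt
      ... | o , r≡ = contradiction (trans (sym (right-true s o (≤-trans (s≤s (m≤n+m o (right s′ + n))) (≤-reflexive r≡))))
                       (trans (e-mirror (s + o) (s′ + right s′) mirror) (right-false s′))) λ ()
        where
        shape₅ : ∀ s r L n t h′ → s + r + (suc L + n) + t + h′ ≡ s + (r + (suc L + n) + t + h′)
        shape₅ = solve-∀
        shape₆ : ∀ r L n t o h h′ → suc ((o + h) + (r + (suc L + n) + t + h′)) ≡ suc (r + (h + h′)) + (suc (t + n) + o + L)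
        shape₆ = solve-∀
        mirror : ∀ h h′ → h + h′ ≡ n → x (s + o + h) ≡ x (s′ + right s′ + h′)
        mirror h h′ sum = trans (cong x (+-assoc s o h)) (trans
          (pal′ (o + h) (r + (suc L + n) + right s′ + h′) (trans (shape₆ r L n (right s′) o h h′)
            (cong₂ (λ k k′ → suc (r + k) + (k′ + L)) sum r≡)))
          (cong x (sym (shape₅ s r L n (right s′) h′))))

    factorization : ∀ ps s m → PalFactorization (seg x s m) ps → PalLength≤ (gather del x s m) (length ps * c)
    factorization [] s zero    _ = PalLength≤-[]
    factorization (p ∷ ps) s m ((_ , pal) ∷ pals , eq) =
      subst (λ w → PalLength≤ w (c + length ps * c)) (sym pieces) (PalLength≤-++
        (palindrome s (length p) (palindrome-at x s (length p)
          (subst (λ w → w ≡ reverse w) (sym head) pal)))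
        (factorization ps (s + length p) (length (concat ps)) (pals , rest)))
      where
      head = proj₁ (seg-++ x s m eq)
      rest = proj₂ (seg-++ x s m eq)
      pieces : gather del x s m ≡ gather del x s (length p) ++ gather del x (s + length p) (length (concat ps))
      pieces = trans (cong (gather del x s) (trans (sym (seg-length x s m)) (trans (cong length eq) (length-++ p))))
        (gather-split del x s (length p) _)

    -- The factor of x̄ arises from a factor of x, which has at most k palindromes, each costing at
    -- most c after the deletion.
    reducedFactor : ∀ j m → PalLength≤ (seg x̄ j m) (k * c)
    reducedFactor j m with seg-φ j m
    ... | d , _ , seg-eq with factor (φ j) d
    ...   | ps , pals , le = subst (λ w → PalLength≤ w (k * c)) (sym (seg-eq x))
      (PalLength≤-mono (*-monoˡ-≤ c le) (factorization ps (φ j) d pals))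

  reducedStart : ℕ → ℕ
  reducedStart zero    = 0
  reducedStart (suc i) = suc (reducedStart i + g (gap i))

  left-start : ∀ i → left (start i) ≡ 0
  left-start zero    = refl
  left-start (suc i) = left-false _ (right-false (start i))

  φ-start : ∀ i → φ (reducedStart i) ≡ start i
  φ-start zero    = refl
  φ-start (suc i) = begin
    φ (suc (b + g (gap i)))             ≡⟨ cong (φ ∘ suc) (+-comm b _) ⟩
    φ (suc (g (right (start i))) + b)   ≡⟨ cong (λ k → φ (suc (g (right k)) + b)) (sym (φ-start i)) ⟩
    φ (suc (g (right (φ b))) + b)       ≡⟨ φ-next b (trans (cong left (φ-start i)) (left-start i)) ⟩
    suc (φ b + right (φ b))             ≡⟨ cong (λ k → suc (k + right k)) (φ-start i) ⟩
    start (suc i)                       ∎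
    where
    open ≡-Reasoning
    b = reducedStart i

  φ-inside : ∀ i h → h < g (gap i) → φ (reducedStart i + h) ≡ start i + h
  φ-inside i h h< = trans (cong φ (+-comm (reducedStart i) h)) (trans
    (φ-run (reducedStart i) (trans (cong left (φ-start i)) (left-start i)) h
      (subst (λ k → h < g (right k)) (sym (φ-start i)) h<))
    (cong (_+ h) (φ-start i)))

  φ-gap : ∀ i → φ (reducedStart i + g (gap i)) ≡ start i + gap i
  φ-gap i = trans (cong φ (+-comm (reducedStart i) _)) (trans
    (cong (λ k → φ (g (right k) + reducedStart i)) (sym (φ-start i))) (trans
    (φ-end (reducedStart i) (trans (cong left (φ-start i)) (left-start i)))
    (cong (λ k → k + right k) (φ-start i))))

  ē : ℕ → Bool
  ē = e ∘ φ

  ē-inside : ∀ i h → h < g (gap i) → ē (reducedStart i + h) ≡ true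
  ē-inside i h h< = trans (cong e (φ-inside i h h<)) (right-true (start i) h (≤-trans h< (g≤ _)))

  ē-gap : ∀ i → ē (reducedStart i + g (gap i)) ≡ false
  ē-gap i = trans (cong e (φ-gap i)) (right-false (start i))

  reducedStart-≥ : ∀ i → i ≤ reducedStart i
  reducedStart-≥ zero    = z≤n
  reducedStart-≥ (suc i) = s≤s (≤-trans (reducedStart-≥ i) (m≤m+n _ _))

  reducedCode : ℕ → List A × ℕ
  reducedCode i = separator i , g (gap i)

  -- The period P of x̄ counts positions, that of the code counts blocks. The position closing block
  -- N is again unmarked when moved by P, so it closes some block, namely `r + suc N`; hence P
  -- positions amount to `suc r` blocks.
  EP-reducedCode : EventuallyPeriodic x̄ → EventuallyPeriodic reducedCode
  EP-reducedCode (N , p , per) = suc N , r , λ i i₀≤i →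
    case m≤n⇒∃[o]m+o≡n i₀≤i of λ where
      (t , refl) → subst (λ i → reducedCode (suc r + i) ≡ reducedCode i)
        (+-comm t (suc N)) (cong₂ _,_ (sameSeparator (t + suc N) (late t) (aligned t)) (sameGap (t + suc N) (late t) (aligned t)))
    where
    P = suc p
    windowPeriod : ∀ j h → N ≤ j → h ≤ n → x (φ (P + j) + h) ≡ x (φ j + h)
    windowPeriod j h N≤j h≤ = begin
      x (φ (P + j) + h)   ≡⟨ sym (window h (P + j) h≤) ⟩
      x̄ (h + (P + j))     ≡⟨ cong x̄ (shape h P j) ⟩
      x̄ (P + (h + j))     ≡⟨ per (h + j) (≤-trans N≤j (m≤n+m j h)) ⟩
      x̄ (h + j)           ≡⟨ window h j h≤ ⟩
      x (φ j + h)         ∎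
      where
      open ≡-Reasoning
      shape : ∀ h p j → h + (p + j) ≡ p + (h + j)
      shape = solve-∀
    ē-period : ∀ j → N ≤ j → ē (P + j) ≡ ē j
    ē-period j N≤j = e-local _ _ λ h h≤ → windowPeriod j h N≤j h≤
    j₀ = reducedStart N + g (gap N)
    N≤j₀ : N ≤ j₀
    N≤j₀ = ≤-trans (reducedStart-≥ N) (m≤m+n _ _)
    found = locate reducedStart (g ∘ gap) (λ _ → refl) (suc N) p
    r = proj₁ found
    h = proj₁ (proj₂ found)
    at : suc j₀ + p ≡ reducedStart (r + suc N) + h
    at = proj₁ (proj₂ (proj₂ found))
    atFalse : ē (reducedStart (r + suc N) + h) ≡ false
    atFalse = trans (cong ē (trans (sym at) (cong suc (+-comm j₀ p)))) (trans (ē-period j₀ N≤j₀) (ē-gap N))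
    h≡ : h ≡ g (gap (r + suc N))
    h≡ with m≤n⇒m<n∨m≡n (proj₂ (proj₂ (proj₂ found)))
    ... | inj₁ h<  = contradiction (trans (sym (ē-inside _ h h<)) atFalse) λ ()
    ... | inj₂ h≡  = h≡
    late : ∀ t → N ≤ reducedStart (t + suc N)
    late t = ≤-trans (≤-trans (n≤1+n N) (m≤n+m (suc N) t)) (reducedStart-≥ (t + suc N))
    sameGap : ∀ i → N ≤ reducedStart i → reducedStart (suc r + i) ≡ P + reducedStart i → g (gap (suc r + i)) ≡ g (gap i)
    sameGap i N≤ eq with <-cmp (g (gap (suc r + i))) (g (gap i))
    ... | tri≈ _ same _ = same
    ... | tri< lt _ _ = contradiction (trans (sym (ē-inside i _ lt)) (trans
            (sym (ē-period _ (≤-trans N≤ (m≤m+n _ _))))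
            (trans (cong ē (trans (sym (+-assoc P (reducedStart i) (g (gap (suc r + i))))) (cong (_+ g (gap (suc r + i))) (sym eq))))
              (ē-gap (suc r + i))))) λ ()
    ... | tri> _ _ gt = contradiction (trans (sym (ē-inside (suc r + i) _ gt))
            (trans (cong ē (trans (cong (_+ g (gap i)) eq) (+-assoc P (reducedStart i) (g (gap i)))))
              (trans (ē-period _ (≤-trans N≤ (m≤m+n _ _))) (ē-gap i)))) λ ()
    sameSeparator : ∀ i → N ≤ reducedStart i → reducedStart (suc r + i) ≡ P + reducedStart i → separator (suc r + i) ≡ separator i
    sameSeparator i N≤ eq = seg-cong x x _ _ (suc n) λ h h≤ → begin
      x (start (suc r + i) + gap (suc r + i) + h)                    ≡⟨ cong (λ k → x (k + h)) (sym (φ-gap (suc r + i))) ⟩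
      x (φ (reducedStart (suc r + i) + g (gap (suc r + i))) + h)     ≡⟨ cong (λ k → x (φ k + h)) (cong₂ _+_ eq (sameGap i N≤ eq)) ⟩
      x (φ (P + reducedStart i + g (gap i)) + h)                     ≡⟨ cong (λ k → x (φ k + h)) (+-assoc P _ _) ⟩
      x (φ (P + (reducedStart i + g (gap i))) + h)                   ≡⟨ windowPeriod _ h (≤-trans N≤ (m≤m+n _ _)) (s≤s⁻¹ h≤) ⟩
      x (φ (reducedStart i + g (gap i)) + h)                         ≡⟨ cong (λ k → x (k + h)) (φ-gap i) ⟩
      x (start i + gap i + h)                                        ∎
      where open ≡-Reasoning
    aligned : ∀ t → reducedStart (suc r + (t + suc N)) ≡ P + reducedStart (t + suc N)
    aligned zero = sym (trans (+-comm P _) (trans (+-suc _ p) (cong suc (trans at (cong (reducedStart (r + suc N) +_) h≡)))))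
    aligned (suc t) = trans (cong reducedStart (+-suc (suc r) (t + suc N))) (trans
      (cong suc (cong₂ _+_ (aligned t) (sameGap _ (late t) (aligned t))))
      (trans (cong suc (+-assoc P _ _)) (sym (+-suc P _))))


  -- A jump of φ lands on an unmarked position, so consecutive marked positions of x̄ are
  -- consecutive in x.
  left-run : ∀ j m → (∀ h → h ≤ m → ē (j + h) ≡ true) → m ≤ left (φ (j + m))
  left-run j zero    tr = z≤n
  left-run j (suc m) tr = subst (suc m ≤_) (sym left≡) (s≤s (left-run j m λ h h≤ → tr h (m≤n⇒m≤1+n h≤)))
    where
    i = φ (j + m)
    next : φ (j + suc m) ≡ skip (suc i)
    next = cong φ (+-suc j m)
    kept : del (suc i) ≡ false
    kept = ¬-not λ di → contradiction (trans (sym (tr (suc m) ≤-refl))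
      (trans (cong e (trans next (skip-del (suc i) di))) (right-false (suc i)))) λ ()
    left≡ : left (φ (j + suc m)) ≡ suc (left i)
    left≡ = trans (cong left (trans next (skip-kept (suc i) kept))) (left-true i (tr m (n≤1+n m)))

  no-long-run : ∀ b → (∀ ℓ → g ℓ < b) → ∀ j → ¬ (∀ h → h < b → ē (j + h) ≡ true)
  no-long-run zero    g< j tr = contradiction (g< 0) λ ()
  no-long-run (suc b) g< j tr = <⇒≱ (kept⇒ _ (tr b ≤-refl) (kept-φ (j + b)))
    (≤-trans (s≤s⁻¹ (g< _)) (left-run j b λ h h≤ → tr h (s≤s h≤)))

  gather-Fac∞ : ∀ s m → gather del x s m ∈ Fac∞ x̄
  gather-Fac∞ s m with gather-φ 0 (s + m)
  ... | M , _ , seg-eq = length v , seg⇒OccursAt x̄ _ _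
    (proj₂ (seg-++ x̄ 0 M {v} {gather del x s m} (trans (sym (seg-eq x)) (gather-split del x 0 s m))))
    where v = gather del x 0 s

  -- `short` is the form in which the absence of u and its reversal enters: n marked positions cover
  -- 2n letters, the square of a conjugate, and such a square contains one of the two words.
  module ShortRuns (t : List A) (m : ℕ)
    (short : ∀ c → seg x c m ≡ t → ∀ s → c ≤ s → n ≤ right s → ¬ (s + (n + n) ≤ c + m))
    where

    -- As long as 2n marked positions follow c, `short` gives m < 2n, so the occurrence lies inside
    -- the run and can be moved right by n.
    nearEnd : ∀ fuel c → right c ≤ fuel → seg x c m ≡ t → ∃ λ c′ → seg x c′ m ≡ t × right c′ < n + n
    nearEnd fuel c r≤ eq with right c <? n + n
    ... | yes r< = c , eq , r<
    nearEnd zero c r≤ eq | no r≮ = contradiction (≤-trans (≤-trans 1≤n (m≤m+n n n)) (≤-trans (≮⇒≥ r≮) r≤)) λ ()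
    nearEnd (suc fuel) c r≤ eq | no r≮ = nearEnd fuel (c + n) smaller
      (trans (seg-cong x x (c + n) c m λ h h<m → trans (cong x (shape c n h))
        (period (c + h) (right-true c h (≤-trans h<m (<⇒≤ (<-≤-trans m<2n (≮⇒≥ r≮))))))) eq)
      where
      shape : ∀ c n h → c + n + h ≡ c + h + n
      shape = solve-∀
      n≤r : n ≤ right c
      n≤r = ≤-trans (m≤m+n n n) (≮⇒≥ r≮)
      m<2n : m < n + n
      m<2n = ≰⇒> λ 2n≤m → short c eq c ≤-refl n≤r (+-monoʳ-≤ c 2n≤m)
      smaller : right (c + n) ≤ fuel
      smaller = s≤s⁻¹ (≤-trans (≤-trans (m<n+m (right (c + n)) 1≤n) (≤-reflexive (right-+ n c n≤r))) r≤)

    -- A deleted position is preceded by 2n marked ones of its block. For a block beginning behind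
    -- `c + right c` these lie inside the occurrence, against `short`.
    kept-after : ∀ c m′ → seg x c m ≡ t → c + m ≡ c + right c + m′ → ∀ h → h < m′ → del (c + right c + h) ≡ false
    kept-after c m′ eq m≡ zero    h< = del-end _ (trans (cong e (+-identityʳ _)) (right-false c))
    kept-after c m′ eq m≡ (suc h) h< = trans (cong del (+-suc z h)) (¬-not impossible)
      where
      z = c + right c
      y = suc z + h
      impossible : ¬ (del y ≡ true)
      impossible dy with blockStart y
      ... | a , a+ , la , l≤ = short c eq a (≤-trans (m≤m+n c (right c)) (<⇒≤ z<a))
              (≤-trans (≤-trans (m≤m+n n n) 2n≤l) l≤)
              (≤-trans (+-monoʳ-≤ a 2n≤l) (≤-trans (≤-reflexive a+) (≤-trans (≤-reflexive (sym (+-suc z h)))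
                (≤-trans (+-monoʳ-≤ z (<⇒≤ h<)) (≤-reflexive (sym m≡))))))
        where
        2n≤l : n + n ≤ left y
        2n≤l = subst (λ k → n + k ≤ left y) (+-identityʳ n) (del-large y dy)
        z<a : suc z ≤ a
        z<a = +-cancelʳ-≤ (left y) (suc z) a
          (≤-trans (+-monoʳ-≤ (suc z) (left-after-false z h (right-false c))) (≤-reflexive (sym a+)))

    sizeFrom : ∀ a c → a + left c ≡ c → left c ≤ right a → size c ≡ right a
    sizeFrom a c a+ l≤ = trans (cong (λ k → left c + right k) (sym a+)) (right-+ (left c) a l≤)

    -- The part of t on the marked positions from c on is moved left by q * n, the number of
    -- positions deleted from the block. It then ends exactly at the cut, behind which the rest of t
    -- continues unchanged. There is room because a shortened block keeps 2n positions and
    -- `right c < n + n`.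
    transfer : ∀ c → seg x c m ≡ t → right c < n + n → t ∈ Fac∞ x̄
    transfer c eq r< with blockStart c
    ... | a , a+j , la , j≤ℓ with g-multiple (right a)
    ...   | q , ℓ≡ with m≤n⇒∃[o]m+o≡n r≤G
      where
      r≤ℓ : right c ≤ right a
      r≤ℓ = ≤-trans (m≤n+m _ (left c)) (≤-reflexive (sizeFrom a c a+j j≤ℓ))
      r≤G : right c ≤ g (right a)
      r≤G with m≤n⇒m<n∨m≡n (g≤ (right a))
      ... | inj₁ lt = ≤-trans (<⇒≤ r<) (subst (λ k → n + k ≤ g (right a)) (+-identityʳ n) (g-large (right a) lt))
      ... | inj₂ G≡ℓ = ≤-trans r≤ℓ (≤-reflexive (sym G≡ℓ))
    ...     | o , G≡ = subst (_∈ Fac∞ x̄) eq (byCase (≤-total m r))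
      where
      open ≡-Reasoning
      r = right c
      j = left c
      ℓ = right a
      G = g ℓ
      c* = a + o
      shape₁ : ∀ j r k → j + r + k ≡ j + k + r
      shape₁ = solve-∀
      j≡ : j ≡ o + q * n
      j≡ = +-cancelʳ-≡ r j (o + q * n) (begin
        j + r            ≡⟨ sizeFrom a c a+j j≤ℓ ⟩
        ℓ                ≡⟨ ℓ≡ ⟩
        G + q * n        ≡⟨ cong (_+ q * n) (sym G≡) ⟩
        r + o + q * n    ≡⟨ cong (_+ q * n) (+-comm r o) ⟩
        o + r + q * n    ≡⟨ shape₁ o r (q * n) ⟩
        o + q * n + r    ∎)
      same : ∀ m → m ≤ r → seg x c m ≡ seg x c* m
      same m m≤r = seg-cong x x c c* m λ h h<m → trans (cong (λ k → x (k + h)) (trans (sym a+j) (cong (a +_) j≡))) (trans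
        (cong x (shape₂ a o (q * n) h)) (trans
        (shift a ℓ (right-true a) q (o + h) (≤-trans (≤-trans (≤-reflexive (cong suc (shape₁ o h (q * n))))
          (≤-trans (≤-reflexive (sym (+-suc (o + q * n) h)))
          (≤-trans (+-monoʳ-≤ (o + q * n) (≤-trans h<m m≤r))
            (≤-reflexive (trans (cong (_+ r) (sym j≡)) (sizeFrom a c a+j j≤ℓ)))))) (m≤m+n ℓ n)))
        (cong x (sym (+-assoc a o h)))))
        where
        shape₂ : ∀ a o k h → a + (o + k) + h ≡ a + ((o + h) + k)
        shape₂ = solve-∀
      keptStart : ∀ m → m ≤ r → gather del x c* m ≡ seg x c m
      keptStart m m≤r = trans (gather-none del x c* m λ h h<m → trans (cong del (+-assoc a o h))
        (kept-block (o + h) a la (≤-trans (+-monoʳ-< o (≤-trans h<m m≤r)) (≤-reflexive (trans (+-comm o r) G≡)))))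
        (sym (same m m≤r))
      byCase : m ≤ r ⊎ r ≤ m → seg x c m ∈ Fac∞ x̄
      byCase (inj₁ m≤r) = subst (_∈ Fac∞ x̄) (keptStart m m≤r) (gather-Fac∞ c* m)
      byCase (inj₂ r≤m) with m≤n⇒∃[o]m+o≡n r≤m
      ... | m′ , m≡ = subst (_∈ Fac∞ x̄) (begin
          gather del x c* (r + (q * n + m′))
            ≡⟨ gather-split del x c* r _ ⟩
          gather del x c* r ++ gather del x (c* + r) (q * n + m′)
            ≡⟨ cong (gather del x c* r ++_) (gather-split del x (c* + r) (q * n) m′) ⟩
          gather del x c* r ++ gather del x (c* + r) (q * n) ++ gather del x (c* + r + q * n) m′
            ≡⟨ cong₂ _++_ (keptStart r ≤-refl) (cong₂ _++_
                 (gather-all del x (c* + r) (q * n) λ h h< → trans (cong del (trans (cong (_+ h) c*+r) (+-assoc a G h)))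
                   (del-block (G + h) a la (subst (G + h <_) (sym ℓ≡) (+-monoʳ-< G h<)) (m≤m+n G h)))
                 (trans (cong (λ k → gather del x k m′) (trans (shape₃ a o r (q * n)) (cong (_+ r) (trans (cong (a +_) (sym j≡)) a+j))))
                   (gather-none del x (c + r) m′ (kept-after c m′ eq (trans (cong (c +_) (sym m≡)) (sym (+-assoc c r m′))))))) ⟩
          seg x c r ++ seg x (c + r) m′
            ≡⟨ sym (seg-split x c r m′) ⟩
          seg x c (r + m′)
            ≡⟨ cong (seg x c) m≡ ⟩
          seg x c m ∎) (gather-Fac∞ c* (r + (q * n + m′)))
        where
        shape₃ : ∀ a o r k → a + o + r + k ≡ a + (o + k) + r
        shape₃ = solve-∀
        c*+r : c* + r ≡ a + G
        c*+r = trans (+-assoc a o r) (cong (a +_) (trans (+-comm o r) G≡))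

    survives : ∀ c → seg x c m ≡ t → t ∈ Fac∞ x̄
    survives c eq = let (c′ , eq′ , r<) = nearEnd (right c) c ≤-refl eq in transfer c′ eq′ r<

-- Conjugates, powers and the marking of positions

leastFalse : ∀ (b : ℕ → Bool) r → b r ≡ false → ∃ λ m → (∀ h → h < m → b h ≡ true) × b m ≡ false
leastFalse b r br = byCase (b 0) refl r br
  where
  byCase : ∀ c → b 0 ≡ c → ∀ r → b r ≡ false → ∃ λ m → (∀ h → h < m → b h ≡ true) × b m ≡ false
  byCase false b0 _       _  = 0 , (λ _ ()) , b0
  byCase true  b0 zero    br = contradiction (trans (sym b0) br) λ ()
  byCase true  b0 (suc r) br = let (m , tr , fl) = leastFalse (b ∘ suc) r br in
    suc m , (λ { zero _ → b0 ; (suc h) (s≤s h<) → tr h h< }) , fl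

-- Rotations of u and of its reversal are taken together, which makes the marking invariant under
-- reversal.
Conjugate : List A → List A → Set
Conjugate u w = ∃₂ λ α β → w ≡ α ++ β × (β ++ α ≡ u ⊎ β ++ α ≡ reverse u)

Conjugate-rotate : ∀ {u : List A} a w → Conjugate u (a ∷ w) → Conjugate u (w ∷ʳ a)
Conjugate-rotate {u = u} a w ([] , b ∷ β , refl , root) = w , [ a ] , refl , subst (λ v → v ≡ u ⊎ v ≡ reverse u) (++-identityʳ (a ∷ w)) root
Conjugate-rotate {u = u} a w (b ∷ α , β , eq , root) with ∷-injective eq
... | refl , refl = α , β ∷ʳ a , ++-assoc α β [ a ] ,
  subst (λ v → v ≡ u ⊎ v ≡ reverse u) (sym (++-assoc β [ a ] α)) root

Conjugate-reverse : ∀ {u : List A} w → Conjugate u w → Conjugate u (reverse w)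
Conjugate-reverse {u = u} w (α , β , refl , root) = reverse β , reverse α , reverse-++ α β ,
  (case root of λ where
    (inj₁ eq) → inj₂ (trans (sym (reverse-++ β α)) (cong reverse eq))
    (inj₂ eq) → inj₁ (trans (sym (reverse-++ β α)) (trans (cong reverse eq) (reverse-involutive u))))

-- v is a window of length |u| + 1 of a word with period |u| whose root is conjugate to u or to its
-- reversal.
Edge : List A → List A → Set
Edge u v = ∃₂ λ a w → v ≡ a ∷ (w ∷ʳ a) × Conjugate u (a ∷ w)

Edge-reverse : ∀ {u : List A} v → Edge u v → Edge u (reverse v)
Edge-reverse v (a , w , refl , conj) = a , reverse w ,
  trans (unfold-reverse a (w ∷ʳ a)) (cong (_∷ʳ a) (reverse-++ w [ a ])) ,
  subst (Conjugate _) (reverse-++ w [ a ]) (Conjugate-reverse (w ∷ʳ a) (Conjugate-rotate a w conj))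

Edge⇒ : ∀ {u : List A} (x : ℕ → A) i m → Edge u (seg x i (suc (suc m))) →
  Conjugate u (seg x i (suc m)) × x (i + suc m) ≡ x i
Edge⇒ {u = u} x i m (a , w , eq , conj) with ∷ʳ-injective (seg x i (suc m)) (a ∷ w) (trans (sym (seg-snoc x i (suc m))) eq)
... | eq₁ , eq₂ = subst (Conjugate u) (sym eq₁) conj , trans eq₂ (sym (∷-injectiveˡ eq₁))

⇒Edge : ∀ {u : List A} (x : ℕ → A) i m → Conjugate u (seg x i (suc m)) → x (i + suc m) ≡ x i →
  Edge u (seg x i (suc (suc m)))
⇒Edge x i m conj eq = x i , seg x (suc i) m ,
  trans (seg-snoc x i (suc m)) (cong (λ a → x i ∷ (seg x (suc i) m ∷ʳ a)) eq) , conj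

Conjugate-next : ∀ {u : List A} (x : ℕ → A) i m → Conjugate u (seg x i (suc m)) → x (i + suc m) ≡ x i →
  Conjugate u (seg x (suc i) (suc m))
Conjugate-next {u = u} x i m conj eq = subst (Conjugate u)
  (sym (trans (seg-snoc x (suc i) m) (cong (seg x (suc i) m ∷ʳ_) (trans (cong x (sym (+-suc i m))) eq))))
  (Conjugate-rotate (x i) (seg x (suc i) m) conj)

^ʷ-comm : ∀ (v : List A) m → v ++ v ^ʷ m ≡ v ^ʷ m ++ v
^ʷ-comm v zero    = ++-identityʳ v
^ʷ-comm v (suc m) = trans (cong (v ++_) (^ʷ-comm v m)) (sym (++-assoc v (v ^ʷ m) v))

length-^ʷ : ∀ (v : List A) m → length (v ^ʷ m) ≡ m * length v
length-^ʷ v zero    = refl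
length-^ʷ v (suc m) = trans (length-++ v) (cong (length v +_) (length-^ʷ v m))

-- The factorizations v · v^m and v^m · v of the power exhibit two occurrences of v^m at distance
-- |v|.
power-period : ∀ (y : ℕ → A) v m j → OccursAt y (v ^ʷ suc m) j →
  seg y j (length v) ≡ v × (∀ h → h < m * length v → y (j + h + length v) ≡ y (j + h))
power-period y v m j occ = proj₁ front , λ h h< → trans (cong y (shape j h (length v)))
  (seg-at y y (j + length v) j (m * length v) (trans
    (subst (λ k → seg y (j + length v) k ≡ v ^ʷ m) (length-^ʷ v m) (proj₂ front))
    (sym (subst (λ k → seg y j k ≡ v ^ʷ m) (length-^ʷ v m) (proj₁ back)))) h h<)
  where
  whole : seg y j (length (v ^ʷ suc m)) ≡ v ^ʷ suc m
  whole = OccursAt⇒seg y j occ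
  front = seg-++ y j _ {v} {v ^ʷ m} whole
  back  = seg-++ y j _ {v ^ʷ m} {v} (trans whole (^ʷ-comm v m))
  shape : ∀ j h l → j + h + l ≡ j + l + h
  shape = solve-∀

seg-Fac : ∀ (x : ℕ → A) c o l r {v} → seg x (c + o) l ≡ v → v ∈ Fac (seg x c (o + (l + r)))
seg-Fac x c o l r {v} refl = subst (λ w → v ∈ Fac w)
  (sym (trans (seg-split x c o (l + r)) (cong (seg x c o ++_) (seg-split x (c + o) l r))))
  (fromView (MkView (seg x c o) (≡⇒Pointwise-≡ refl) (seg x (c + o + l) r)))

-- The square of αβ is α(βα)β, and βα is u or its reversal.
Conjugate-Fac : ∀ {u : List A} (x : ℕ → A) c o n r → length u ≡ n → Conjugate u (seg x (c + o) n) →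
  (∀ h → h < n → x (c + o + h + n) ≡ x (c + o + h)) →
  u ∈ Fac (seg x c (o + (n + n + r))) ⊎ reverse u ∈ Fac (seg x c (o + (n + n + r)))
Conjugate-Fac {u = u} x c o n r len (α , β , eq , root) per = case root of λ where
    (inj₁ e) → inj₁ (subst (λ w → w ∈ Fac _) e found)
    (inj₂ e) → inj₂ (subst (λ w → w ∈ Fac _) e found)
  where
  open ≡-Reasoning
  a = length α
  b = length β
  s = c + o
  n≡ : n ≡ a + b
  n≡ = trans (sym (seg-length x s n)) (trans (cong length eq) (length-++ α))
  square : seg x s (n + n) ≡ α ++ ((β ++ α) ++ β)
  square = begin
    seg x s (n + n)             ≡⟨ seg-split x s n n ⟩
    seg x s n ++ seg x (s + n) n ≡⟨ cong (seg x s n ++_) (seg-cong x x (s + n) s n λ h h< → trans (cong x (shape s n h)) (per h h<)) ⟩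
    seg x s n ++ seg x s n      ≡⟨ cong₂ _++_ eq eq ⟩
    (α ++ β) ++ (α ++ β)        ≡⟨ ++-assoc α β (α ++ β) ⟩
    α ++ (β ++ (α ++ β))        ≡⟨ cong (α ++_) (sym (++-assoc β α β)) ⟩
    α ++ ((β ++ α) ++ β)        ∎
    where
    shape : ∀ s n h → s + n + h ≡ s + h + n
    shape = solve-∀
  middle : seg x (s + a) (length (β ++ α)) ≡ β ++ α
  middle = proj₁ (seg-++ x (s + a) _ {β ++ α} {β} (proj₂ (seg-++ x s (n + n) {α} {(β ++ α) ++ β} square)))
  found : (β ++ α) ∈ Fac (seg x c (o + (n + n + r)))
  found = subst (λ m → (β ++ α) ∈ Fac (seg x c m)) total
    (seg-Fac x c (o + a) (length (β ++ α)) (b + r) (trans (cong (λ k → seg x k (length (β ++ α))) (sym (+-assoc c o a))) middle))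
    where
    shape : ∀ o a b r → o + a + ((b + a) + (b + r)) ≡ o + ((a + b) + (a + b) + r)
    shape = solve-∀
    total : o + a + (length (β ++ α) + (b + r)) ≡ o + (n + n + r)
    total = trans (cong (λ k → o + a + (k + (b + r))) (length-++ β)) (trans (shape o a b r)
      (cong (λ k → o + (k + k + r)) (sym n≡)))

-- The marking of x and the choice of the new block lengths

¬∀⇒∃¬ : ExcludedMiddle 0ℓ → {P : A → Set} → ¬ (∀ a → P a) → ∃ λ a → ¬ P a
¬∀⇒∃¬ em {P} ¬∀ with em {∃ λ a → ¬ P a}
... | yes found = found
... | no none = contradiction (λ a → decidable-stable em λ ¬p → none (a , ¬p)) ¬∀

decided : ∀ {P : Set} (P? : Dec P) → does P? ≡ true → P
decided (yes p) _ = p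

module Construction (em : ExcludedMiddle 0ℓ) {A : Set} (a₀ : A) (u′ : List A)
  (x : InfiniteWord A) (aperiodic : ¬ EventuallyPeriodic x) where

  u : List A
  u = a₀ ∷ u′

  n : ℕ
  n = length u

  1≤n : 1 ≤ n
  1≤n = s≤s z≤n

  e : ℕ → Bool
  e i = does (em {Edge u (seg x i (suc n))})

  e⇒Edge : ∀ i → e i ≡ true → Edge u (seg x i (suc n))
  e⇒Edge i = decided em

  Edge⇒e : ∀ i → Edge u (seg x i (suc n)) → e i ≡ true
  Edge⇒e i = dec-true em

  e-iff : ∀ i j → (Edge u (seg x i (suc n)) → Edge u (seg x j (suc n))) →
    (Edge u (seg x j (suc n)) → Edge u (seg x i (suc n))) → e i ≡ e j
  e-iff i j to from with em {Edge u (seg x j (suc n))}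
  ... | yes edge = dec-true em (from edge)
  ... | no ¬edge = dec-false em (¬edge ∘ to)

  period : ∀ i → e i ≡ true → x (i + n) ≡ x i
  period i ei = proj₂ (Edge⇒ x i (length u′) (e⇒Edge i ei))

  e-local : ∀ i j → (∀ h → h ≤ n → x (i + h) ≡ x (j + h)) → e i ≡ e j
  e-local i j eq = e-iff i j (subst (Edge u) windows) (subst (Edge u) (sym windows))
    where
    windows : seg x i (suc n) ≡ seg x j (suc n)
    windows = seg-cong x x i j (suc n) λ h h< → eq h (s≤s⁻¹ h<)

  e-mirror : ∀ i j → (∀ h h′ → h + h′ ≡ n → x (i + h) ≡ x (j + h′)) → e i ≡ e j
  e-mirror i j eq = e-iff i j
    (λ edge → subst (Edge u) (trans (cong reverse windows) (reverse-involutive _)) (Edge-reverse _ edge))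
    (λ edge → subst (Edge u) (sym windows) (Edge-reverse _ edge))
    where
    windows : seg x i (suc n) ≡ reverse (seg x j (suc n))
    windows = seg-reverse x x j i (suc n) λ h h′ sum → eq h h′ (suc-injective sum)

  -- A block without end would give x the period n from i on.
  blockEnds : ∀ i → ∃ λ r → e (i + r) ≡ false
  blockEnds i with em {∃ λ r → e (i + r) ≡ false}
  ... | yes ends = ends
  ... | no never = contradiction (i , length u′ , eventually) aperiodic
    where
    eventually : ∀ j → i ≤ j → x (n + j) ≡ x j
    eventually j i≤j with m≤n⇒∃[o]m+o≡n i≤j
    ... | o , refl = trans (cong x (+-comm n (i + o))) (period (i + o) (¬-not λ fl → never (o , fl)))

  blockEnd : ∀ i → ∃ λ m → (∀ h → h < m → e (i + h) ≡ true) × e (i + m) ≡ false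
  blockEnd i = let (r , fl) = blockEnds i in leastFalse (λ h → e (i + h)) r fl

  right : ℕ → ℕ
  right i = proj₁ (blockEnd i)

  right-true : ∀ i h → h < right i → e (i + h) ≡ true
  right-true i = proj₁ (proj₂ (blockEnd i))

  right-false : ∀ i → e (i + right i) ≡ false
  right-false i = proj₂ (proj₂ (blockEnd i))

  copies : Bool → ℕ
  copies c = 2 + (if c then 1 else 0)

  -- Keeping the remainder modulo n makes the deleted number a multiple of n. Colour `true` leaves
  -- at least 3n positions of a long block and `false` fewer, so comparison with 3n reads the colour
  -- back; short blocks always read as `false`.
  reduce : (ℕ → Bool) → ℕ → ℕ
  reduce f ℓ = if does (ℓ <? 3 * n) then ℓ else copies (f ℓ) * n + ℓ % n

  reduce-short : ∀ f ℓ → ℓ < 3 * n → reduce f ℓ ≡ ℓ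
  reduce-short f ℓ lt rewrite dec-true (ℓ <? 3 * n) lt = refl

  reduce-long : ∀ f ℓ → ¬ (ℓ < 3 * n) → reduce f ℓ ≡ copies (f ℓ) * n + ℓ % n
  reduce-long f ℓ nlt rewrite dec-false (ℓ <? 3 * n) nlt = refl

  copies≤3 : ∀ c → copies c ≤ 3
  copies≤3 true  = ≤-refl
  copies≤3 false = n≤1+n 2

  reduce-multiple : ∀ f ℓ → ∃ λ q → ℓ ≡ reduce f ℓ + q * n
  reduce-multiple f ℓ with ℓ <? 3 * n
  ... | yes lt = 0 , trans (sym (+-identityʳ ℓ)) (cong (_+ 0) (sym (reduce-short f ℓ lt)))
  ... | no nlt with m≤n⇒∃[o]m+o≡n (≤-trans (copies≤3 (f ℓ))
    (subst (_≤ ℓ / n) (m*n/n≡m 3 n) (/-monoˡ-≤ n (≮⇒≥ nlt))))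
  ...   | q , eq = q , (begin
    ℓ                                        ≡⟨ m≡m%n+[m/n]*n ℓ n ⟩
    ℓ % n + ℓ / n * n                        ≡⟨ cong (λ k → ℓ % n + k * n) (sym eq) ⟩
    ℓ % n + (copies (f ℓ) + q) * n           ≡⟨ shape (ℓ % n) (copies (f ℓ)) q n ⟩
    copies (f ℓ) * n + ℓ % n + q * n         ≡⟨ cong (_+ q * n) (sym (reduce-long f ℓ nlt)) ⟩
    reduce f ℓ + q * n                       ∎)
    where
    open ≡-Reasoning
    shape : ∀ r c q n → r + (c + q) * n ≡ c * n + r + q * n
    shape = solve-∀

  reduce-large : ∀ f ℓ → reduce f ℓ < ℓ → 2 * n ≤ reduce f ℓ
  reduce-large f ℓ lt with ℓ <? 3 * n
  ... | yes short = contradiction (reduce-short f ℓ short) (<⇒≢ lt)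
  ... | no long = subst (2 * n ≤_) (sym (reduce-long f ℓ long))
    (≤-trans (*-monoˡ-≤ n (m≤m+n 2 (if f ℓ then 1 else 0))) (m≤m+n _ _))

  reduce-< : ∀ f ℓ → reduce f ℓ < 4 * n
  reduce-< f ℓ with ℓ <? 3 * n
  ... | yes short = subst (_< 4 * n) (sym (reduce-short f ℓ short)) (<-≤-trans short (m≤n+m (3 * n) n))
  ... | no long = subst (_< 4 * n) (sym (reduce-long f ℓ long))
    (<-≤-trans (+-mono-≤-< (*-monoˡ-≤ n (copies≤3 (f ℓ))) (m%n<n ℓ n)) (≤-reflexive (+-comm (3 * n) n)))

  module Word (f : ℕ → Bool) =
    ReducedWord e right right-true right-false n 1≤n (reduce f) (reduce-multiple f) (reduce-large f)
      x period e-local e-mirror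

  open Segments e right right-true n 1≤n x period using (gap; separator; EP-code)

  recoverColour : (ℕ → Bool) → ℕ → Bool
  recoverColour f ℓ = does (3 * n ≤? reduce f ℓ)

  recover : ∀ f → (∀ m → m < 3 * n → f m ≡ false) → ∀ ℓ → recoverColour f ℓ ≡ f ℓ
  recover f low ℓ with ℓ <? 3 * n
  ... | yes short = trans (dec-false (3 * n ≤? reduce f ℓ) (<⇒≱ (subst (_< 3 * n) (sym (reduce-short f ℓ short)) short)))
                      (sym (low ℓ short))
  ... | no long = byColour (f ℓ) refl
    where
    byColour : ∀ c → f ℓ ≡ c → recoverColour f ℓ ≡ f ℓ
    byColour true  fℓ = trans (dec-true (3 * n ≤? reduce f ℓ) (subst (3 * n ≤_)
      (sym (trans (reduce-long f ℓ long) (cong (λ c → copies c * n + ℓ % n) fℓ))) (m≤m+n _ _))) (sym fℓ)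
    byColour false fℓ = trans (dec-false (3 * n ≤? reduce f ℓ) (<⇒≱ (subst (_< 3 * n)
      (sym (trans (reduce-long f ℓ long) (cong (λ c → copies c * n + ℓ % n) fℓ)))
      (<-≤-trans (+-monoʳ-< (2 * n) (m%n<n ℓ n)) (≤-reflexive (+-comm (2 * n) n)))))) (sym fℓ)

  -- Under the constant colour `true` every long block keeps at least 3n positions, so the lengths
  -- truncated at 3n can be read off x̄. They are the base from which `EP-colourings` starts.
  truncate : ∀ ℓ → reduce (λ _ → true) ℓ ⊓ (3 * n) ≡ ℓ ⊓ (3 * n)
  truncate ℓ with ℓ <? 3 * n
  ... | yes short = cong (_⊓ (3 * n)) (reduce-short _ ℓ short)
  ... | no long = trans (cong (_⊓ (3 * n)) (reduce-long _ ℓ long))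
    (trans (m≥n⇒m⊓n≡n (m≤m+n (3 * n) (ℓ % n))) (sym (m≥n⇒m⊓n≡n (≮⇒≥ long))))

  aperiodicReduction : ∃ λ f → ¬ EventuallyPeriodic (Word.x̄ f)
  aperiodicReduction = ¬∀⇒∃¬ em λ all → let reducedCode = λ f → Word.EP-reducedCode f (all f) in
    -- The separators do not depend on the colouring, so a single one supplies them; the gaps use
    -- all colourings.
    aperiodic (EP-code (EP-pair (EP-map proj₁ (reducedCode (λ _ → false)))
      (gaps λ f → EP-map proj₂ (reducedCode f))))
    where
    gaps : (∀ f → EventuallyPeriodic (λ i → reduce f (gap i))) → EventuallyPeriodic gap
    gaps reducedGap = EP-colourings em gap (3 * n)
      (λ f low → EP-cong (λ i → recover f low (gap i)) (EP-map (λ ℓ → does (3 * n ≤? ℓ)) (reducedGap f)))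
      (EP-cong (λ i → truncate (gap i)) (EP-map (_⊓ (3 * n)) (reducedGap (λ _ → true))))

  module Properties (f : ℕ → Bool) where
    open Word f

    -- A fifth power of a conjugate would yield 4n consecutive positions in a reduced block.
    no-fifth-power : ∀ v → Conjugate u v → length v ≡ n → v ^ʷ 5 ∉ Fac∞ x̄
    no-fifth-power v conj len (j , occ) = no-long-run (4 * n) (reduce-< f) j λ h h< →
      Edge⇒e (φ (j + h)) (subst (Edge u) (windows h) (⇒Edge x̄ (j + h) (length u′) (conjugate h (<⇒≤ h<)) (per h h<)))
      where
      found = power-period x̄ v 4 j occ
      per : ∀ h → h < 4 * n → x̄ (j + h + n) ≡ x̄ (j + h)
      per h h< = subst (λ l → x̄ (j + h + l) ≡ x̄ (j + h)) len (proj₂ found h (subst (λ l → h < 4 * l) (sym len) h<))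
      conjugate : ∀ h → h ≤ 4 * n → Conjugate u (seg x̄ (j + h) n)
      conjugate zero    _  = subst (Conjugate u)
        (trans (sym (proj₁ found)) (cong₂ (seg x̄) (sym (+-identityʳ j)) len)) conj
      conjugate (suc h) h≤ = subst (λ i → Conjugate u (seg x̄ i n)) (sym (+-suc j h))
        (Conjugate-next x̄ (j + h) (length u′) (conjugate h (<⇒≤ h≤)) (per h h≤))
      windows : ∀ h → seg x̄ (j + h) (suc n) ≡ seg x (φ (j + h)) (suc n)
      windows h = seg-cong x̄ x (j + h) (φ (j + h)) (suc n) λ i i< →
        trans (cong x̄ (+-comm (j + h) i)) (window i (j + h) (s≤s⁻¹ i<))

    Ψ⊆Fac∞ : Ψ x u ⊆ Fac∞ x̄
    Ψ⊆Fac∞ {t} ((c , occ) , ¬u , ¬uᴿ) = ShortRuns.survives t m short c (OccursAt⇒seg x c occ)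
      where
      m = length t
      short : ∀ c → seg x c m ≡ t → ∀ s → c ≤ s → n ≤ right s → ¬ (s + (n + n) ≤ c + m)
      short c eq s c≤s n≤r s≤ with m≤n⇒∃[o]m+o≡n c≤s
      ... | o , refl with m≤n⇒∃[o]m+o≡n (+-cancelˡ-≤ c _ m (subst (_≤ c + m) (+-assoc c o (n + n)) s≤))
      ...   | r , m≡ = case Conjugate-Fac {u = u} x c o n r refl
                (proj₁ (Edge⇒ x (c + o) (length u′) (e⇒Edge (c + o) (pos-right (c + o) (≤-trans 1≤n n≤r)))))
                (λ h h<n → period (c + o + h) (right-true (c + o) h (≤-trans h<n n≤r))) of λ where
          (inj₁ found) → ¬u (subst (λ w → u ∈ Fac w) whole found)
          (inj₂ found) → ¬uᴿ (subst (λ w → reverse u ∈ Fac w) whole found)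
        where
        whole : seg x c (o + (n + n + r)) ≡ t
        whole = trans (cong (seg x c) (trans (sym (+-assoc o (n + n) r)) m≡)) eq

-- The numerical bound and the theorem

MaxPL≤⇒PalLength≤ : ∀ (x : InfiniteWord A) k → MaxPL≤ x k → ∀ s m → PalLength≤ (seg x s m) k
MaxPL≤⇒PalLength≤ x k max s zero    = PalLength≤-[]
MaxPL≤⇒PalLength≤ x k max s (suc m) =
  let (l , ((ps , pals , len) , _) , l≤k) = max (seg x s (suc m)) (λ ()) (s , seg⇒OccursAt x s (suc m) refl)
  in ps , pals , subst (_≤ k) (sym len) l≤k

-- The case k = 1 is separate because k(3k + 1) exceeds 3k^3 there. All factors of length 2 are then
-- palindromes, so x is constant.
MaxPL≤1⇒EP : ∀ (x : InfiniteWord A) → MaxPL≤ x 1 → EventuallyPeriodic x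
MaxPL≤1⇒EP x max = 0 , 0 , λ i _ → constant i (MaxPL≤⇒PalLength≤ x 1 max i 2)
  where
  constant : ∀ i → PalLength≤ (seg x i 2) 1 → x (suc i) ≡ x i
  constant i (p ∷ [] , ((_ , pal) ∷ [] , eq) , _) = sym (∷-injectiveˡ
    (subst (λ w → w ≡ reverse w) (sym (trans eq (++-identityʳ p))) pal))
  constant i (p ∷ q ∷ ps , _ , s≤s ())

palindromeBound : ∀ k → 2 ≤ k → k * (k + (1 + (k + k))) ≤ 3 * k ^ 3
palindromeBound k 2≤k = begin
  k * (k + (1 + (k + k)))   ≡⟨ cong (k *_) (shape k) ⟩
  k * (3 * k + 1)           ≤⟨ *-monoʳ-≤ k (+-monoʳ-≤ (3 * k) (≤-trans (<⇒≤ 2≤k) (m≤m+n k (2 * k)))) ⟩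
  k * (3 * k + 3 * k)       ≡⟨ shape′ k ⟩
  2 * (3 * (k * k))         ≤⟨ *-monoˡ-≤ (3 * (k * k)) 2≤k ⟩
  k * (3 * (k * k))         ≡⟨ shape″ k ⟩
  3 * k ^ 3                 ∎
  where
  open ≤-Reasoning
  shape : ∀ k → k + (1 + (k + k)) ≡ 3 * k + 1
  shape = solve-∀
  shape′ : ∀ k → k * (3 * k + 3 * k) ≡ 2 * (3 * (k * k))
  shape′ = solve-∀
  shape″ : ∀ k → k * (3 * (k * k)) ≡ 3 * (k * (k * (k * 1)))
  shape″ = solve-∀

theorem1p4 :
    ExcludedMiddle 0ℓ →
    (A : Set) (n : ℕ) → A ↔ Fin n →
    (x : InfiniteWord A) → ¬ UltimatelyPeriodic x →
    (u : List A) → u ∈ Fac∞ x → 1 ≤ length u → Primitive u →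
    Recurrent x (u ^ʷ 5) →
    (k : ℕ) → 1 ≤ k → MaxPL≤ x k →
    ∃ λ (x̄ : InfiniteWord A) →
      ¬ UltimatelyPeriodic x̄ ×
      u ^ʷ 5 ∉ Fac∞ x̄ ×
      reverse u ^ʷ 5 ∉ Fac∞ x̄ ×
      Ψ x u ⊆ Fac∞ x̄ ×
      MaxPL≤ x̄ (3 * k ^ 3)
theorem1p4 em A _ _ x ¬up u@(a₀ ∷ u′) _ _ _ _ 1 _ max = contradiction (EP⇒UltimatelyPeriodic (MaxPL≤1⇒EP x max)) ¬up
theorem1p4 em A _ _ x ¬up u@(a₀ ∷ u′) _ _ _ _ k@(suc (suc _)) _ max =
  x̄ , ¬ep ∘ UltimatelyPeriodic⇒EP ,
  no-fifth-power u ([] , u , refl , inj₁ (++-identityʳ u)) refl ,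
  no-fifth-power (reverse u) ([] , reverse u , refl , inj₂ (++-identityʳ (reverse u))) (length-reverse u) ,
  Ψ⊆Fac∞ , λ t t≢[] (j , occ) → PalLength≤⇒PL em (3 * k ^ 3)
    (PalLength≤-mono (palindromeBound k (s≤s (s≤s z≤n)))
      (subst (λ w → PalLength≤ w (k * c)) (OccursAt⇒seg x̄ j occ) (reducedFactor j (length t))))
  where
  open Construction em a₀ u′ x (¬up ∘ EP⇒UltimatelyPeriodic) hiding (u)
  f   = proj₁ aperiodicReduction
  ¬ep = proj₂ aperiodicReduction
  open Word f
  open Properties f
  open PalindromicLength k (MaxPL≤⇒PalLength≤ x k max)
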